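{- Let $n,k$ be positive integers with $2k+1\le n$. Let $$Q_{n,k} := s_{n-k-1}\cdots s_1\;\; s_{n-k-1}\cdots s_2\;\;\cdots\;\; s_{n-k-1}s_{n-k-2}\;\; s_{n-k-1}$$ be the triangulated reduced word for the longest element $[n-k,\ldots,1]$ of the symmetric group $S_{n-k}$, where $s_i=(i,i+1)$. Let $Q'_{n,k}$ be the word obtained from $Q_{n,k}$ by deleting all letters $s_i$ with $1\le i\le k$, and let $$\pi_{n,k} := [1,\ldots,k,\,n-k,\,n-k-1,\ldots,k+1]\in S_{n-k}$$ (in one-line notation). Then the simplicial complex $\Delta_{n,k}$ of $k$-triangulations of a convex $n$-gon is equal (i.e., isomorphic as a simplicial complex, under a canonical identification of diagonals with letters of $Q'_{n,k}$) to the subword complex $\Delta(Q'_{n,k},\pi_{n,k})$.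
   Context: Label the vertices of a convex $n$-gon $1,\ldots,n$ in cyclic order; $\overline{ij}$ denotes the segment between vertices $i$ and $j$. Two diagonals cross if their endpoints strictly interleave around the polygon. A $(k+1)$-crossing is a set of $k+1$ mutually crossing diagonals. Let $\Gamma_{n,k}:=\{\overline{ij} : k<|i-j|<n-k\}$. The simplicial complex $\Delta_{n,k}$ has vertex set $\Gamma_{n,k}$ and faces the subsets of $\Gamma_{n,k}$ containing no $(k+1)$-crossing; its facets (maximal faces) are the $k$-triangulations. For a word $Q=w_1\cdots w_m$ in the simple transpositions of a symmetric group and a permutation $\pi$, the subword complex $\Delta(Q,\pi)$ is the simplicial complex on the vertex set $\{1,\ldots,m\}$ (positions of letters, distinct even if letters coincide) whose faces are the subsets $F$ such that the subword of $Q$ formed by the positions not in $F$ contains a reduced word for $\pi$; thus facets are the sets whose complement is a reduced word for $\pi$. -}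

module Defs where

open import Data.Nat using (ℕ; zero; suc; _+_; _∸_; _<_; _<?_; _≤_)
open import Data.Bool using (Bool; true; false; if_then_else_)
open import Data.List using (List; []; _∷_; length; filter; map; concat; foldl; reverse; _++_; upTo; applyUpTo)
open import Data.List.Relation.Unary.All using (All)
open import Data.List.Relation.Unary.AllPairs using (AllPairs)
open import Data.Product using (_×_; _,_; Σ; proj₁; proj₂)
open import Data.Sum using (_⊎_)
open import Data.Fin using (Fin)
open import Data.Fin.Subset using (Subset; _∈_; _⊆_; ∁)
open import Data.Vec using (Vec; []; _∷_; lookup; tabulate)
open import Relation.Binary.PropositionalEquality using (_≡_)
open import Relation.Nullary using (¬_)
open import Function.Bundles using (_↔_; Inverse)

-- Diagonals of the convex n-gon with vertices 1..n.
-- A diagonal ij is stored as the pair (i , j) with i < j.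

Diag : Set
Diag = ℕ × ℕ

range : ℕ → ℕ → List ℕ
range a b = applyUpTo (λ t → a + t) (suc b ∸ a)

Γ : ℕ → ℕ → List Diag
Γ n k = concat (map (λ i → map (λ j → (i , j))
          (filter (λ j → (k <? (j ∸ i))) (filter (λ j → ((j ∸ i) <? (n ∸ k))) (range (suc i) n))))
          (range 1 n))

Crosses : Diag → Diag → Set
Crosses (a , b) (c , d) = (a < c × c < b × b < d) ⊎ (c < a × a < d × d < b)

-- Faces of Δ_{n,k}: subsets of Γ_{n,k} (indexed by positions in the list Γ n k)
-- containing no (k+1)-crossing, i.e. no k+1 mutually crossing diagonals.
-- (Mutual crossing forces the listed diagonals to be distinct.)
IsFaceΔ : (n k : ℕ) → Subset (length (Γ n k)) → Set
IsFaceΔ n k F =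
  ¬ (Σ (List (Fin (length (Γ n k)))) λ L →
       length L ≡ suc k
     × All (λ i → i ∈ F) L
     × AllPairs (λ i j → Crosses (Data.List.lookup (Γ n k) i) (Data.List.lookup (Γ n k) j)) L)

-- Words in simple transpositions: the letter i (a natural number) stands for s_i = (i,i+1).
-- Permutations of S_N are in one-line notation as lists [w(1),...,w(N)].

swapAt : ℕ → List ℕ → List ℕ
swapAt (suc zero) (x ∷ y ∷ r) = y ∷ x ∷ r
swapAt (suc (suc i)) (x ∷ r) = x ∷ swapAt (suc i) r
swapAt _ l = l

idPerm : ℕ → List ℕ
idPerm N = range 1 N

-- product s_{w1} s_{w2} ... s_{wm} in S_N, one-line notation
-- (right multiplication by s_i swaps positions i and i+1)
evalWord : ℕ → List ℕ → List ℕ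
evalWord N w = foldl (λ p i → swapAt i p) (idPerm N) w

inversions : List ℕ → ℕ
inversions [] = 0
inversions (x ∷ r) = length (filter (λ y → y <? x) r) + inversions r

IsReducedWordFor : ℕ → List ℕ → List ℕ → Set
IsReducedWordFor N w π = evalWord N w ≡ π × length w ≡ inversions π

subword : (w : List ℕ) → Subset (length w) → List ℕ
subword [] [] = []
subword (x ∷ w) (b ∷ G) = if b then x ∷ subword w G else subword w G

IsFaceSubword : (N : ℕ) (Q : List ℕ) (π : List ℕ) → Subset (length Q) → Set
IsFaceSubword N Q π F =
  Σ (Subset (length Q)) λ G → G ⊆ ∁ F × IsReducedWordFor N (subword Q G) π

down : ℕ → ℕ → List ℕ
down a b = reverse (range b a)

Qword : ℕ → ℕ → List ℕ
Qword n k = concat (map (λ j → down (n ∸ k ∸ 1) j) (range 1 (n ∸ k ∸ 1)))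

Q′word : ℕ → ℕ → List ℕ
Q′word n k = filter (λ i → k <? i) (Qword n k)

πperm : ℕ → ℕ → List ℕ
πperm n k = range 1 k ++ reverse (range (suc k) (n ∸ k))

imageSubset : ∀ {a b} → (Fin a ↔ Fin b) → Subset a → Subset b
imageSubset σ F = tabulate (λ p → lookup F (Inverse.from σ p))

{-# OPTIONS --safe --termination-depth=2 #-}

-- The letter of Q′ at the place of the diagonal (a , b) of Γ (both in their list order) is n − (b − a).
-- Run a subword of Q′ on the identity and let h r i count the entries > n − u at positions > i after the letters of
-- the diagonals starting at 1 , … , r.  A swap s_i changes only the count at i, and this count is always ≥ the count
-- at i + 1 and ≥ the count at i − 1 minus 1.  Take the subword of the complement of F that swaps exactly at ascents.
-- Writing [r , i] for 1 if the diagonal starting at r with letter i is in F and for 0 otherwise, it satisfies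
--   h r i + r = max (h r (i + 1) + r , h (r − 1) (i − 1) + (r − 1) , h (r − 1) i + (r − 1) + [r , i]),
-- the recursion for the longest chain in F, and a chain of k + 1 diagonals (a , b) with a ≤ u < b is a
-- (k + 1)-crossing.  So F has a (k + 1)-crossing separated by some u iff some entry > n − u survives at a position > u;
-- for an arbitrary subword of the complement ≥ still holds, which gives the converse.

module Submission where

open import Defs
open import Data.Empty using (⊥; ⊥-elim)
open import Data.List using (List; []; _∷_; length; filter; map; concat; foldl; reverse; _++_; applyUpTo; applyDownFrom; take; drop; lookup)
open import Data.Nat using (ℕ; zero; suc; _+_; _*_; _∸_; _≤_; _<_; _>_; z≤n; s≤s; _<?_; _≤?_; _≤ᵇ_; _<ᵇ_; _≟_)
open import Data.Nat.Properties
open import Data.Nat.Tactic.RingSolver using (solve)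
open import Data.Product using (Σ; _×_; _,_; proj₁; proj₂; ∃)
open import Relation.Binary.PropositionalEquality using (_≡_; _≢_; refl; sym; trans; cong; cong₂; subst; subst₂; setoid; resp₂; module ≡-Reasoning)

-- Linear arithmetic for letters, heights and chains.

-- Linear inequalities are proved by adding up hypotheses to a ≤ b and cancelling.
≤-by : ∀ {a b} x y → a ≤ b → x + b ≡ y + a → x ≤ y
≤-by {a} {b} x y a≤b eq = +-cancelʳ-≤ a x y (≤-trans (+-monoʳ-≤ x a≤b) (≤-reflexive eq))

-- Here `x` is the letter and `δ` the length of a diagonal starting at `a`. Throughout, `suc M + k`
-- is n, so permutations have size `suc M` and the largest letter is `M`.
letter-bounds : ∀ {k M} x δ a → δ < suc M → k < δ → x + δ ≡ suc M + k → δ + a ≤ suc M + k → k < x × x ≤ M × a ≤ x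
letter-bounds {k} {M} x δ a δ<M k<δ x+δ a+δ =
    ≤-by (suc k) x (+-mono-≤ δ<M (≤-reflexive (sym x+δ))) (solve (x ∷ δ ∷ k ∷ M ∷ []))
  , ≤-by x M (+-mono-≤ k<δ (≤-reflexive x+δ)) (solve (x ∷ δ ∷ k ∷ M ∷ []))
  , ≤-by a x (+-mono-≤ a+δ (≤-reflexive (sym x+δ))) (solve (x ∷ δ ∷ a ∷ k ∷ M ∷ []))

codiagonal-bounds : ∀ {k M} ℓ e → ℓ + e ≡ suc M + k → k < ℓ → ℓ ≤ M → k < e × e < suc M
codiagonal-bounds {k} {M} ℓ e total k<ℓ ℓ≤M =
    ≤-by (suc k) e (+-mono-≤ ℓ≤M (≤-reflexive (sym total))) (solve (k ∷ M ∷ ℓ ∷ e ∷ []))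
  , ≤-by (suc e) (suc M) (+-mono-≤ k<ℓ (≤-reflexive total)) (solve (k ∷ M ∷ ℓ ∷ e ∷ []))

-- The lemmas named `trace-…` are the bookkeeping of `trace`: `h` is the height in row `r` at letter
-- `ℓ`, and `c` counts the diagonals still to be found.
trace-left : ∀ {u c h r k} → h + k ≡ u → u + suc c ≤ h + r + k → r + k + 1 ≤ suc c + k → ⊥
trace-left {u} {c} {h} {r} {k} h+k h₁ h₂ = 1+n≰n {0}
  (≤-by 1 0 (+-mono-≤ (+-mono-≤ (≤-reflexive h+k) h₁) h₂) (solve (u ∷ c ∷ h ∷ r ∷ k ∷ [])))

trace-bottom : ∀ {u c h k} → h + k ≤ u → u + suc c ≤ h + 0 + k → ⊥
trace-bottom {u} {c} {h} {k} h+k h₁ = 1+n≰n {c}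
  (≤-trans (m≤n+m (suc c) c) (≤-by (c + suc c) c (+-mono-≤ h+k h₁) (solve (u ∷ c ∷ h ∷ k ∷ []))))

trace-right : ∀ {h M} → 1 ≤ h → h + suc M ≤ suc M → ⊥
trace-right {h} {M} h≥1 h≤ = 1+n≰n {0} (≤-by 1 0 (+-mono-≤ h≥1 h≤) (solve (h ∷ M ∷ [])))

trace-gain : ∀ {u c h r k} → u + suc c ≤ h + suc r + k → u + c ≤ h + r + k
trace-gain {u} {c} {h} {r} {k} le = ≤-by (u + c) (h + r + k) le (solve (u ∷ c ∷ h ∷ r ∷ k ∷ []))

trace-gain′ : ∀ {c r k ℓ} → suc r + k + 1 ≤ suc c + ℓ → r + k + 1 ≤ c + ℓ
trace-gain′ {c} {r} {k} {ℓ} le = ≤-by (r + k + 1) (c + ℓ) le (solve (c ∷ r ∷ k ∷ ℓ ∷ []))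

trace-separated : ∀ {u c h r k ℓ e M} → u + suc c ≤ h + r + k → h + ℓ ≤ suc M → ℓ + e ≡ suc M + k → u < r + e
trace-separated {u} {c} {h} {r} {k} {ℓ} {e} {M} h₁ h₂ total =
  ≤-by (suc u) (r + e) (+-mono-≤ (+-mono-≤ h₁ h₂) (+-mono-≤ (≤-reflexive (sym total)) (z≤n {c})))
    (solve (u ∷ c ∷ h ∷ r ∷ k ∷ ℓ ∷ e ∷ M ∷ []))

trace-up : ∀ {c r k ℓ} → r + k + 1 ≤ c + ℓ → r + k + 1 ≤ c + suc ℓ
trace-up {c} {r} {k} {ℓ} le = ≤-trans le (+-monoʳ-≤ c (n≤1+n ℓ))

trace-diagonal : ∀ {u c h r k} → u + c ≤ h + suc r + k → u + c ≤ suc h + r + k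
trace-diagonal {u} {c} {h} {r} {k} le = ≤-by (u + c) (suc h + r + k) le (solve (u ∷ c ∷ h ∷ r ∷ k ∷ []))

trace-diagonal′ : ∀ {c r k ℓ} → suc r + k + 1 ≤ c + suc ℓ → r + k + 1 ≤ c + ℓ
trace-diagonal′ {c} {r} {k} {ℓ} le = ≤-by (r + k + 1) (c + ℓ) le (solve (c ∷ r ∷ k ∷ ℓ ∷ []))

trace-start : ∀ {u h k} → 1 ≤ h → u + suc k ≤ h + u + k
trace-start {u} {h} {k} h≥1 = ≤-by (u + suc k) (h + u + k) h≥1 (solve (u ∷ h ∷ k ∷ []))

trace-start′ : ∀ u k → u + k + 1 ≤ suc k + u
trace-start′ u k = ≤-reflexive (solve (u ∷ k ∷ []))

chain-base : ∀ {u h₀ h r k} → h₀ + k ≡ u → h₀ + 0 ≤ h + r → u + 0 ≤ h + r + k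
chain-base {u} {h₀} {h} {r} {k} eq le =
  ≤-by (u + 0) (h + r + k) (+-mono-≤ (≤-reflexive (sym eq)) le) (solve (u ∷ h₀ ∷ h ∷ r ∷ k ∷ []))

chain-base′ : ∀ {u ℓ r w n} → u + w ≡ n → u + ℓ ≤ r + n → 0 + ℓ ≤ r + w
chain-base′ {u} {ℓ} {r} {w} {n} eq le =
  ≤-by (0 + ℓ) (r + w) (+-mono-≤ (≤-reflexive (sym eq)) le) (solve (u ∷ ℓ ∷ r ∷ w ∷ n ∷ []))

chain-step : ∀ {u c h′ h a r k} → u + c ≤ h′ + a + k → h′ + suc a ≤ h + r → u + suc c ≤ h + r + k
chain-step {u} {c} {h′} {h} {a} {r} {k} h₁ h₂ =
  ≤-by (u + suc c) (h + r + k) (+-mono-≤ h₁ h₂) (solve (u ∷ c ∷ h′ ∷ h ∷ a ∷ r ∷ k ∷ []))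

-- A bound `b + ℓ ≤ r + n` says that `b` is at most `r + (n − ℓ)`, the end of the diagonal that
-- starts at `r` and has letter `ℓ`.
chain-cone : ∀ {a b x δ ℓ r n} → b + ℓ ≤ r + n → x + δ ≡ n → δ + a ≡ b → a + ℓ ≤ r + x
chain-cone {a} {b} {x} {δ} {ℓ} {r} {n} h₁ h₂ h₃ =
  ≤-by (a + ℓ) (r + x) (+-mono-≤ h₁ (+-mono-≤ (≤-reflexive (sym h₂)) (≤-reflexive h₃)))
    (solve (a ∷ b ∷ x ∷ δ ∷ ℓ ∷ r ∷ n ∷ []))

chain-cone′ : ∀ {a b c x δ n} → c < b → x + δ ≡ n → δ + suc a ≡ b → c + x ≤ a + n
chain-cone′ {a} {b} {c} {x} {δ} {n} h₁ h₂ h₃ =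
  ≤-by (c + x) (a + n) (+-mono-≤ h₁ (+-mono-≤ (≤-reflexive h₂) (≤-reflexive (sym h₃))))
    (solve (a ∷ b ∷ c ∷ x ∷ δ ∷ n ∷ []))

mono-diagonal : ∀ {s ℓ r ℓ′} → s + suc ℓ ≤ suc r + ℓ′ → s + ℓ ≤ r + ℓ′
mono-diagonal {s} {ℓ} {r} {ℓ′} le = ≤-by (s + ℓ) (r + ℓ′) le (solve (s ∷ ℓ ∷ r ∷ ℓ′ ∷ []))

mono-step : ∀ {x y z r} → x ≤ y + r → y ≤ suc z → x ≤ z + suc r
mono-step {x} {y} {z} {r} h₁ h₂ = ≤-by x (z + suc r) (+-mono-≤ h₁ h₂) (solve (x ∷ y ∷ z ∷ r ∷ []))

boundary-height : ∀ {h w u k M} → h + w ≡ suc M → u + w ≡ suc M + k → h + k ≡ u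
boundary-height {h} {w} {u} {k} {M} h₁ h₂ = ≤-antisym
  (≤-by (h + k) u (+-mono-≤ (≤-reflexive h₁) (≤-reflexive (sym h₂))) (solve (h ∷ w ∷ u ∷ k ∷ M ∷ [])))
  (≤-by u (h + k) (+-mono-≤ (≤-reflexive (sym h₁)) (≤-reflexive h₂)) (solve (h ∷ w ∷ u ∷ k ∷ M ∷ [])))

opposite-≤ : ∀ {u w k x} → u + w ≡ x + k → k ≤ u → w ≤ x
opposite-≤ {u} {w} {k} {x} eq le = ≤-by w x (+-mono-≤ (≤-reflexive eq) le) (solve (u ∷ w ∷ k ∷ x ∷ []))

opposite-≥ : ∀ {u w k x} → u + w ≡ x + k → u ≤ x → k ≤ w
opposite-≥ {u} {w} {k} {x} eq le =
  ≤-by k w (+-mono-≤ (≤-reflexive (sym eq)) le) (solve (u ∷ w ∷ k ∷ x ∷ []))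

regroup : ∀ k i j → k + i + (k + j) ≡ k + k + (i + j)
regroup k i j = solve (k ∷ i ∷ j ∷ [])

regroup′ : ∀ k m → k + k + suc m ≡ suc (k + m) + k
regroup′ k m = solve (k ∷ m ∷ [])

opposite-sum : ∀ {k m} i j → i + j ≡ suc m → k + i + (k + j) ≡ suc (k + m) + k
opposite-sum {k} {m} i j eq = trans (regroup k i j) (trans (cong (k + k +_) eq) (regroup′ k m))

opposite-sum⁻ : ∀ {k m} i j → k + i + (k + j) ≡ suc (k + m) + k → i + j ≡ suc m
opposite-sum⁻ {k} {m} i j eq = +-cancelˡ-≡ (k + k) (i + j) (suc m)
  (trans (sym (regroup k i j)) (trans eq (sym (regroup′ k m))))

height-positive : ∀ {u h k} → u + suc k ≤ h + u + k → 1 ≤ h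
height-positive {u} {h} {k} le = ≤-by 1 h le (solve (u ∷ h ∷ k ∷ []))

n-split : ∀ k m → 2 * k + 1 + m ≡ suc (k + m) + k
n-split k m = solve (k ∷ m ∷ [])

open import Algebra.Properties.CommutativeSemigroup +-commutativeSemigroup using (x∙yz≈y∙xz)
open import Data.Bool using (Bool; true; false; if_then_else_; _∧_; not; T)
open import Data.Bool.Properties using (¬-not)
open import Data.Fin as Fin using (Fin; cast)
open import Data.Fin.Properties using (cast-is-id; cast-involutive)
open import Data.Fin.Subset as Subset using (Subset; _⊆_; ∁)
open import Data.Fin.Subset.Properties using (x∉p⇒x∈∁p; x∈∁p⇒x∉p)
open import Data.List.Membership.Propositional using (_∈_)
open import Data.List.Membership.Propositional.Properties using (∈-map⁺; ∈-map⁻; ∈-filter⁺; ∈-filter⁻; ∈-applyUpTo⁺; ∈-applyUpTo⁻; ∈-∃++; ∈-insert; ∈-concat⁻′; ∈-lookup)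
open import Data.List.Properties using (filter-accept; filter-reject; filter-none; filter-++; take++drop≡id; length-applyUpTo; length-drop; length-map; applyUpTo-∷ʳ; reverse-applyUpTo; concat-map; map-∘; map-cong; concatMap-++; ++-identityʳ; foldl-++)
open import Data.List.Relation.Binary.Permutation.Propositional using (_↭_; ↭-sym; ↭⇒↭ₛ)
open import Data.List.Relation.Binary.Permutation.Propositional.Properties using (All-resp-↭; ↭-length; ↭-reverse)
import Data.List.Relation.Binary.Permutation.Setoid.Properties as Permutation
open import Data.List.Relation.Binary.Pointwise using (Pointwise; []; _∷_)
open import Data.List.Relation.Unary.All as All using (All; []; _∷_)
import Data.List.Relation.Unary.All.Properties as All
open import Data.List.Relation.Unary.AllPairs as AllPairs using (AllPairs; []; _∷_)
import Data.List.Relation.Unary.AllPairs.Properties as AllPairs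
open import Data.List.Relation.Unary.Any using (here; there)
open import Data.List.Relation.Unary.Any.Properties using (reverse⁺; reverse⁻)
import Data.List.Relation.Unary.Sorted.TotalOrder.Properties as Sorted
open import Data.List.Relation.Unary.Unique.Propositional using (Unique)
import Data.List.Sort as Sort
open import Data.Nat.ListAction using (sum)
open import Data.Nat.ListAction.Properties using (sum-++; sum-↭)
import Data.Product.Properties as Product
open import Data.Sum as Sum using (_⊎_; inj₁; inj₂)
open import Data.Vec as Vec using ([]; _∷_)
open import Data.Vec.Properties using (lookup∘tabulate; lookup⇒[]=; []=⇒lookup)
open import Function using (_∘_; _on_)
open import Function.Bundles using (_↔_; _⇔_; mk↔ₛ′; mk⇔)
open import Relation.Binary.Bundles using (DecTotalOrder)
import Relation.Binary.Construct.Flip.EqAndOrd as Flip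
import Relation.Binary.Construct.On as On
open import Relation.Binary.Definitions using (DecidableEquality)
open import Relation.Nullary using (yes; no)
open import Relation.Unary using (Decidable)

-- Counting large entries past a position.

bit : ℕ → ℕ → ℕ
bit v x = if v ≤ᵇ x then 1 else 0

-- above v p i is the number of entries ≥ v of p at (1-indexed) positions > i.
above : ℕ → List ℕ → ℕ → ℕ
above v []      i       = 0
above v (x ∷ p) zero    = bit v x + above v p zero
above v (x ∷ p) (suc i) = above v p i

bit≤1 : ∀ v x → bit v x ≤ 1
bit≤1 v x with v ≤ᵇ x
... | true  = ≤-refl
... | false = z≤n

bit-mono : ∀ v {x y} → x ≤ y → bit v x ≤ bit v y
bit-mono v {x} {y} x≤y with v ≤ᵇ x in v≤x | v ≤ᵇ y in v≤y
... | false | _     = z≤n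
... | true  | true  = ≤-refl
... | true  | false = ⊥-elim (subst T v≤y (≤⇒≤ᵇ (≤-trans (≤ᵇ⇒≤ v x (subst T (sym v≤x) _)) x≤y)))

bit≡0⇒< : ∀ v x → bit v x ≡ 0 → x < v
bit≡0⇒< v x eq with v ≤ᵇ x in v≤x
... | false = ≰⇒> λ v≤x′ → subst T v≤x (≤⇒≤ᵇ v≤x′)

bit≡1 : ∀ {v x} → v ≤ x → bit v x ≡ 1
bit≡1 {v} {x} v≤x with v ≤ᵇ x in eq
... | true  = refl
... | false = ⊥-elim (subst T eq (≤⇒≤ᵇ v≤x))

bit≡0 : ∀ {v x} → x < v → bit v x ≡ 0
bit≡0 {v} {x} x<v with v ≤ᵇ x in eq
... | false = refl
... | true  = ⊥-elim (<⇒≱ x<v (≤ᵇ⇒≤ v x (subst T (sym eq) _)))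

above-suc-≤ : ∀ v p i → above v p (suc i) ≤ above v p i
above-suc-≤ v []          i       = z≤n
above-suc-≤ v (x ∷ p)     (suc i) = above-suc-≤ v p i
above-suc-≤ v (x ∷ p)     zero    = m≤n+m (above v p 0) (bit v x)

above-≤-suc : ∀ v p i → above v p i ≤ suc (above v p (suc i))
above-≤-suc v []      i       = z≤n
above-≤-suc v (x ∷ p) (suc i) = above-≤-suc v p i
above-≤-suc v (x ∷ p) zero    = +-monoˡ-≤ (above v p 0) (bit≤1 v x)

above-antitone : ∀ v p {i j} → i ≤ j → above v p j ≤ above v p i
above-antitone v p {i} {zero} z≤n = ≤-refl
above-antitone v p {i} {suc j} i≤j with m≤n⇒m<n∨m≡n i≤j
... | inj₁ i<j = ≤-trans (above-suc-≤ v p j) (above-antitone v p (≤-pred i<j))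
... | inj₂ refl = ≤-refl

above-≤-length : ∀ v p i → above v p i ≤ length p ∸ i
above-≤-length v []      zero    = z≤n
above-≤-length v []      (suc i) = z≤n
above-≤-length v (x ∷ p) zero    = +-mono-≤ (bit≤1 v x) (above-≤-length v p 0)
above-≤-length v (x ∷ p) (suc i) = above-≤-length v p i

above-swapAt-0 : ∀ v i p → above v (swapAt i p) 0 ≡ above v p 0
above-swapAt-0 v zero          p           = refl
above-swapAt-0 v (suc zero)    []          = refl
above-swapAt-0 v (suc zero)    (x ∷ [])    = refl
above-swapAt-0 v (suc zero)    (x ∷ y ∷ p) = x∙yz≈y∙xz (bit v y) (bit v x) (above v p 0)
above-swapAt-0 v (suc (suc i)) []          = refl
above-swapAt-0 v (suc (suc i)) (x ∷ p)     = cong (bit v x +_) (above-swapAt-0 v (suc i) p)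

above-swapAt : ∀ v i p j → j ≢ i → above v (swapAt i p) j ≡ above v p j
above-swapAt v i             p           zero          j≢i = above-swapAt-0 v i p
above-swapAt v zero          p           (suc j)       j≢i = refl
above-swapAt v (suc zero)    []          (suc j)       j≢i = refl
above-swapAt v (suc zero)    (x ∷ [])    (suc j)       j≢i = refl
above-swapAt v (suc zero)    (x ∷ y ∷ p) (suc zero)    j≢i = ⊥-elim (j≢i refl)
above-swapAt v (suc zero)    (x ∷ y ∷ p) (suc (suc j)) j≢i = refl
above-swapAt v (suc (suc i)) []          (suc j)       j≢i = refl
above-swapAt v (suc (suc i)) (x ∷ p)     (suc j)       j≢i = above-swapAt v (suc i) p j (j≢i ∘ cong suc)

length-swapAt : ∀ i p → length (swapAt i p) ≡ length p
length-swapAt zero          p           = refl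
length-swapAt (suc zero)    []          = refl
length-swapAt (suc zero)    (x ∷ [])    = refl
length-swapAt (suc zero)    (x ∷ y ∷ p) = refl
length-swapAt (suc (suc i)) []          = refl
length-swapAt (suc (suc i)) (x ∷ p)     = cong suc (length-swapAt (suc i) p)

sum-swapAt : ∀ i p → sum (swapAt i p) ≡ sum p
sum-swapAt zero          p           = refl
sum-swapAt (suc zero)    []          = refl
sum-swapAt (suc zero)    (x ∷ [])    = refl
sum-swapAt (suc zero)    (x ∷ y ∷ p) = x∙yz≈y∙xz y x (sum p)
sum-swapAt (suc (suc i)) []          = refl
sum-swapAt (suc (suc i)) (x ∷ p)     = cong (x +_) (sum-swapAt (suc i) p)

take-swapAt : ∀ k i p → k < i → take k (swapAt i p) ≡ take k p
take-swapAt zero    i             p       k<i       = refl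
take-swapAt (suc k) (suc zero)    p       (s≤s ())
take-swapAt (suc k) (suc (suc i)) []      k<i       = refl
take-swapAt (suc k) (suc (suc i)) (x ∷ p) (s≤s k<i) = cong (x ∷_) (take-swapAt k (suc i) p k<i)

-- Ascents and inversions.

ascent : ℕ → List ℕ → Bool
ascent (suc zero)    (x ∷ y ∷ p) = x <ᵇ y
ascent (suc (suc i)) (x ∷ p)     = ascent (suc i) p
ascent _             _           = false

ascent-swapAt : ∀ i p → ascent i p ≡ true → ascent i (swapAt i p) ≡ false
ascent-swapAt (suc zero) (x ∷ y ∷ p) eq with y <ᵇ x in y<x
... | false = refl
... | true  = ⊥-elim (<-asym (<ᵇ⇒< x y (subst T (sym eq) _)) (<ᵇ⇒< y x (subst T (sym y<x) _)))
ascent-swapAt (suc (suc i)) (x ∷ p) eq = ascent-swapAt (suc i) p eq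

-- Without an ascent, an entry ≥ `v` in the second of the two positions forces one in the first. So
-- one of the two general bounds on the count at `suc i` is attained, which produces the maximum in
-- the recursion.
above-nonascent : ∀ v i p → ascent (suc i) p ≡ false →
  above v p (suc i) ≡ above v p (suc (suc i)) ⊎ above v p i ≡ suc (above v p (suc i))
above-nonascent v i       []          asc = inj₁ refl
above-nonascent v zero    (x ∷ [])    asc = inj₁ refl
above-nonascent v zero    (x ∷ y ∷ p) asc with bit v y in by
... | zero = inj₁ refl
... | suc b = inj₂ (cong (_+ suc (b + above v p 0)) bx)
  where
  y≤x : y ≤ x
  y≤x = ≮⇒≥ λ x<y → subst T asc (<⇒<ᵇ x<y)
  bx : bit v x ≡ 1
  bx = ≤-antisym (bit≤1 v x) (≤-trans (≤-trans (s≤s z≤n) (≤-reflexive (sym by))) (bit-mono v y≤x))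
above-nonascent v (suc i) (x ∷ p)     asc = above-nonascent v i p asc

smaller : ℕ → List ℕ → ℕ
smaller x p = length (filter (_<? x) p)

smaller-swapAt : ∀ x i p → smaller x (swapAt i p) ≡ smaller x p
smaller-swapAt x zero          p           = refl
smaller-swapAt x (suc zero)    []          = refl
smaller-swapAt x (suc zero)    (y ∷ [])    = refl
smaller-swapAt x (suc zero)    (y ∷ z ∷ p) with y <ᵇ x in yx | z <ᵇ x in zx
... | true  | true  rewrite yx | zx = refl
... | true  | false rewrite yx | zx = refl
... | false | true  rewrite yx | zx = refl
... | false | false rewrite yx | zx = refl
smaller-swapAt x (suc (suc i)) []          = refl
smaller-swapAt x (suc (suc i)) (y ∷ p) with y <ᵇ x
... | true  = cong suc (smaller-swapAt x (suc i) p)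
... | false = smaller-swapAt x (suc i) p

inversions-swapAt : ∀ i p → ascent i p ≡ true → inversions (swapAt i p) ≡ suc (inversions p)
inversions-swapAt (suc zero) (x ∷ y ∷ p) asc
  rewrite filter-accept (_<? y) {xs = p} (<ᵇ⇒< x y (subst T (sym asc) _))
        | filter-reject (_<? x) {x = y} {xs = p} (<-asym (<ᵇ⇒< x y (subst T (sym asc) _)))
  = cong suc (x∙yz≈y∙xz (smaller y p) (smaller x p) (inversions p))
inversions-swapAt (suc (suc i)) (x ∷ p) asc =
  trans (cong₂ _+_ (smaller-swapAt x (suc i) p) (inversions-swapAt (suc i) p asc)) (+-suc (smaller x p) (inversions p))

-- Recognising π by its counts.

applyUpTo-+ : ∀ {A : Set} (f : ℕ → A) k m → applyUpTo f (k + m) ≡ applyUpTo f k ++ applyUpTo (λ i → f (k + i)) m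
applyUpTo-+ f zero    m = refl
applyUpTo-+ f (suc k) m = cong (f 0 ∷_) (applyUpTo-+ (f ∘ suc) k m)

take-length-++ : ∀ {A : Set} (xs ys : List A) → take (length xs) (xs ++ ys) ≡ xs
take-length-++ []       ys = refl
take-length-++ (x ∷ xs) ys = cong (x ∷_) (take-length-++ xs ys)

above-length-++ : ∀ v xs ys i → above v (xs ++ ys) (length xs + i) ≡ above v ys i
above-length-++ v []       ys i = refl
above-length-++ v (x ∷ xs) ys i = above-length-++ v xs ys i

above-drop : ∀ v k p i → above v (drop k p) i ≡ above v p (k + i)
above-drop v zero    p       i = refl
above-drop v (suc k) []      i = refl
above-drop v (suc k) (x ∷ p) i = above-drop v k p i

above-∷ʳ : ∀ v xs y i → i ≤ length xs → above v (xs ++ y ∷ []) i ≡ above v xs i + bit v y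
above-∷ʳ v []       y zero    i≤ = +-comm (bit v y) 0
above-∷ʳ v (x ∷ xs) y zero    i≤ = trans (cong (bit v x +_) (above-∷ʳ v xs y 0 z≤n)) (sym (+-assoc (bit v x) _ _))
above-∷ʳ v (x ∷ xs) y (suc i) i≤ = above-∷ʳ v xs y i (≤-pred i≤)

above-idPerm : ∀ N e i → i ≤ e → above (suc e) (idPerm N) i ≡ N ∸ e
above-idPerm zero    e i i≤e = sym (0∸n≡0 e)
above-idPerm (suc N) e i i≤e with i ≤? N
... | no i≰N = trans
    (n≤0⇒n≡0 (≤-trans (above-≤-length (suc e) (idPerm (suc N)) i)
      (≤-reflexive (trans (cong (_∸ i) (length-applyUpTo suc (suc N))) (m≤n⇒m∸n≡0 (≰⇒> i≰N))))))
    (sym (m≤n⇒m∸n≡0 (≤-trans (≰⇒> i≰N) i≤e)))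
... | yes i≤N = begin
    above (suc e) (idPerm (suc N)) i           ≡⟨ cong (λ p → above (suc e) p i) (applyUpTo-∷ʳ suc N) ⟨
    above (suc e) (idPerm N ++ suc N ∷ []) i   ≡⟨ above-∷ʳ (suc e) (idPerm N) (suc N) i (≤-trans i≤N (≤-reflexive (sym (length-applyUpTo suc N)))) ⟩
    above (suc e) (idPerm N) i + bit (suc e) (suc N) ≡⟨ cong (_+ bit (suc e) (suc N)) (above-idPerm N e i i≤e) ⟩
    N ∸ e + bit (suc e) (suc N)                ≡⟨ last ⟩
    suc N ∸ e                                  ∎
  where
  open ≡-Reasoning
  last : N ∸ e + bit (suc e) (suc N) ≡ suc N ∸ e
  last with e ≤? N
  ... | yes e≤N = trans (cong (N ∸ e +_) (bit≡1 {suc e} {suc N} (s≤s e≤N))) (trans (+-comm (N ∸ e) 1) (sym (+-∸-assoc 1 e≤N)))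
  ... | no e≰N  = trans (cong₂ _+_ (m≤n⇒m∸n≡0 (<⇒≤ (≰⇒> e≰N))) (bit≡0 {suc e} {suc N} (s≤s (≰⇒> e≰N)))) (sym (m≤n⇒m∸n≡0 (≰⇒> e≰N)))

pointwise-≤-sum : ∀ {p q} → Pointwise _≤_ p q → sum p ≤ sum q
pointwise-≤-sum []        = z≤n
pointwise-≤-sum (x≤y ∷ l) = +-mono-≤ x≤y (pointwise-≤-sum l)

pointwise-≤-sum-≡ : ∀ {p q} → Pointwise _≤_ p q → sum p ≡ sum q → p ≡ q
pointwise-≤-sum-≡ [] eq = refl
pointwise-≤-sum-≡ {x ∷ p} {y ∷ q} (x≤y ∷ l) eq with m≤n⇒m<n∨m≡n x≤y
... | inj₁ x<y  = ⊥-elim (<-irrefl eq (+-mono-<-≤ x<y (pointwise-≤-sum l)))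
... | inj₂ refl = cong (x ∷_) (pointwise-≤-sum-≡ l (+-cancelˡ-≡ x _ _ eq))

decreasing : ℕ → ℕ → List ℕ
decreasing k m = applyDownFrom (suc k +_) m

above-decreasing-0 : ∀ v k m → k + m < v → above v (decreasing k m) 0 ≡ 0
above-decreasing-0 v k zero    lt = refl
above-decreasing-0 v k (suc m) lt =
  cong₂ _+_ (bit≡0 {v} {suc (k + m)} (≤-trans (s≤s (≤-reflexive (sym (+-suc k m)))) lt))
            (above-decreasing-0 v k m (≤-trans (s≤s (+-monoʳ-≤ k (n≤1+n m))) lt))

above-decreasing : ∀ k m i j → i + j ≡ m → above (suc (k + j)) (decreasing k m) i ≡ 0
above-decreasing k m       zero    j refl = above-decreasing-0 (suc (k + j)) k j ≤-refl
above-decreasing k (suc m) (suc i) j eq   = above-decreasing k m i j (suc-injective eq)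

-- The count at `i < m` includes the entry right after position `i`; its vanishing bounds that entry
-- by `k + j`, which is the entry of `decreasing k m` at the same place.
≤-decreasing : ∀ k m q → length q ≡ m → (∀ i j → i + j ≡ m → above (suc (k + j)) q i ≡ 0) → Pointwise _≤_ q (decreasing k m)
≤-decreasing k zero    []      len h = []
≤-decreasing k (suc m) (x ∷ q) len h =
  ≤-trans (≤-pred (bit≡0⇒< (suc (k + suc m)) x (m+n≡0⇒m≡0 _ (h 0 (suc m) refl)))) (≤-reflexive (+-suc k m))
  ∷ ≤-decreasing k m q (suc-injective len) (λ i j eq → h (suc i) j (cong suc eq))

π-split : ∀ k m → range 1 k ++ reverse (range (suc k) (k + m)) ≡ idPerm k ++ decreasing k m
π-split k m = cong (idPerm k ++_) (trans (reverse-applyUpTo (suc k +_) (k + m ∸ k)) (cong (decreasing k) (m+n∸m≡n k m)))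

above-π : ∀ k m i j → i + j ≡ m → above (suc (k + j)) (idPerm k ++ decreasing k m) (k + i) ≡ 0
above-π k m i j eq = trans
  (cong (λ l → above (suc (k + j)) (idPerm k ++ decreasing k m) (l + i)) (sym (length-applyUpTo suc k)))
  (trans (above-length-++ (suc (k + j)) (idPerm k) (decreasing k m) i) (above-decreasing k m i j eq))

take-idPerm : ∀ k m → take k (idPerm (k + m)) ≡ idPerm k
take-idPerm k m = trans (cong (take k) (applyUpTo-+ suc k m))
  (trans (cong (λ l → take l (idPerm k ++ applyUpTo (suc k +_) m)) (sym (length-applyUpTo suc k)))
         (take-length-++ (idPerm k) _))

-- The entries of p are bounded by those of π, so equality of the sums forces p = π.
≡-π : ∀ k m p → length p ≡ k + m → take k p ≡ take k (idPerm (k + m)) → sum p ≡ sum (idPerm (k + m)) →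
  (∀ i j → i + j ≡ m → above (suc (k + j)) p (k + i) ≡ 0) → p ≡ idPerm k ++ decreasing k m
≡-π k m p len pre sum≡ h = trans (sym (take++drop≡id k p)) (cong₂ _++_ pre′ tail≡)
  where
  open ≡-Reasoning
  pre′ : take k p ≡ idPerm k
  pre′ = trans pre (take-idPerm k m)
  sum-tail : sum (drop k p) ≡ sum (decreasing k m)
  sum-tail = +-cancelˡ-≡ (sum (idPerm k)) _ _ (begin
    sum (idPerm k) + sum (drop k p)         ≡⟨ cong (λ l → sum l + sum (drop k p)) pre′ ⟨
    sum (take k p) + sum (drop k p)         ≡⟨ sum-++ (take k p) (drop k p) ⟨
    sum (take k p ++ drop k p)              ≡⟨ cong sum (take++drop≡id k p) ⟩
    sum p                                   ≡⟨ sum≡ ⟩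
    sum (idPerm (k + m))                    ≡⟨ cong sum (applyUpTo-+ suc k m) ⟩
    sum (idPerm k ++ applyUpTo (suc k +_) m) ≡⟨ sum-++ (idPerm k) _ ⟩
    sum (idPerm k) + sum (applyUpTo (suc k +_) m) ≡⟨ cong (sum (idPerm k) +_) (sum-↭ (↭-reverse (applyUpTo (suc k +_) m))) ⟨
    sum (idPerm k) + sum (reverse (applyUpTo (suc k +_) m)) ≡⟨ cong (λ l → sum (idPerm k) + sum l) (reverse-applyUpTo (suc k +_) m) ⟩
    sum (idPerm k) + sum (decreasing k m)   ∎)
  tail≡ : drop k p ≡ decreasing k m
  tail≡ = pointwise-≤-sum-≡
    (≤-decreasing k m (drop k p) (trans (length-drop k p) (trans (cong (_∸ k) len) (m+n∸m≡n k m)))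
      (λ i j eq → trans (above-drop (suc (k + j)) k p i) (h i j eq)))
    sum-tail

-- Rows of Γ and the letters of Q′.

filter-concat : ∀ {A : Set} {P : A → Set} (P? : Decidable P) (xss : List (List A)) → filter P? (concat xss) ≡ concat (map (filter P?) xss)
filter-concat P? []         = refl
filter-concat P? (xs ∷ xss) = trans (filter-++ P? xs (concat xss)) (cong (filter P? xs ++_) (filter-concat P? xss))

letter : ℕ → Diag → ℕ
letter n (a , b) = n ∸ (b ∸ a)

-- Copied from the inner list of `Γ`, so that `Γ n k` is `concat (map (row n k) (range 1 n))` by
-- definition.
row : ℕ → ℕ → ℕ → List Diag
row n k a = map (λ j → (a , j)) (filter (λ j → k <? (j ∸ a)) (filter (λ j → (j ∸ a) <? (n ∸ k)) (range (suc a) n)))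

∈-range⁺ : ∀ {a b x} → a ≤ x → x ≤ b → x ∈ range a b
∈-range⁺ {a} {b} {x} a≤x x≤b =
  subst (_∈ range a b) (m+[n∸m]≡n a≤x) (∈-applyUpTo⁺ (a +_) (∸-monoˡ-< (s≤s x≤b) a≤x))

∈-range⁻ : ∀ {a b x} → x ∈ range a b → a ≤ x × x ≤ b
∈-range⁻ {a} {b} x∈ with i , i< , refl ← ∈-applyUpTo⁻ (a +_) x∈ =
  m≤m+n a i , ≤-pred (subst (suc (a + i) ≤_) (m+[n∸m]≡n {a} (<⇒≤ (m∸n≢0⇒n<m (λ eq → n≮0 (subst (i <_) eq i<)))))
                       (subst (_≤ a + (suc b ∸ a)) (+-suc a i) (+-monoʳ-≤ a i<)))

∈-row⁺ : ∀ {n k a b} → a < b → b ≤ n → k < b ∸ a → b ∸ a < n ∸ k → (a , b) ∈ row n k a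
∈-row⁺ {n} {k} {a} a<b b≤n k< <n∸k =
  ∈-map⁺ (a ,_) (∈-filter⁺ (λ j → k <? (j ∸ a)) (∈-filter⁺ (λ j → (j ∸ a) <? (n ∸ k)) (∈-range⁺ a<b b≤n) <n∸k) k<)

∈-row⁻ : ∀ {n k a d} → d ∈ row n k a →
  proj₁ d ≡ a × a < proj₂ d × proj₂ d ≤ n × k < proj₂ d ∸ a × proj₂ d ∸ a < n ∸ k
∈-row⁻ {n} {k} {a} d∈
  with j , j∈ , refl ← ∈-map⁻ (a ,_) d∈
  with j∈′ , k< ← ∈-filter⁻ (λ j → k <? (j ∸ a)) {xs = filter (λ j → (j ∸ a) <? (n ∸ k)) (range (suc a) n)} j∈
  with j∈″ , <n∸k ← ∈-filter⁻ (λ j → (j ∸ a) <? (n ∸ k)) {xs = range (suc a) n} j∈′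
  with a<j , j≤n ← ∈-range⁻ {suc a} {n} j∈″
  = refl , a<j , j≤n , k< , <n∸k

∸-+-suc : ∀ a i → suc a + i ∸ a ≡ suc i
∸-+-suc a i = trans (cong (_∸ a) (sym (+-suc a i))) (m+n∸m≡n a (suc i))

row-letters-decreasing : ∀ n k a → AllPairs (_>_ on letter n) (row n k a)
row-letters-decreasing n k a = AllPairs.map⁺ (AllPairs.filter⁺ _ (AllPairs.filter⁺ _
  (AllPairs.applyUpTo⁺₁ (suc a +_) (n ∸ a) letters>)))
  where
  letters> : ∀ {i j} → i < j → j < n ∸ a → n ∸ (suc a + j ∸ a) < n ∸ (suc a + i ∸ a)
  letters> {i} {j} i<j j< rewrite ∸-+-suc a i | ∸-+-suc a j = ∸-monoʳ-< (s≤s i<j) (≤-trans j< (m∸n≤m n a))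

-- Both heads are the maximum of the common set of elements. This lets `row-letters` compare
-- memberships only, instead of matching the filters on the two sides.
decreasing-≡ : ∀ {xs ys} → AllPairs _>_ xs → AllPairs _>_ ys →
  (∀ {z} → z ∈ xs → z ∈ ys) → (∀ {z} → z ∈ ys → z ∈ xs) → xs ≡ ys
decreasing-≡ []       []       f g = refl
decreasing-≡ []       (_ ∷ _)  f g with () ← g (here refl)
decreasing-≡ (_ ∷ _)  []       f g with () ← f (here refl)
decreasing-≡ {x ∷ xs} {y ∷ ys} (x> ∷ xs>) (y> ∷ ys>) f g = cong₂ _∷_ x≡y
  (decreasing-≡ xs> ys> (λ z∈ → shrink (f (there z∈)) (λ z≡y → <-irrefl (trans z≡y (sym x≡y)) (All.lookup x> z∈)))
                        (λ z∈ → shrink (g (there z∈)) (λ z≡x → <-irrefl (trans z≡x x≡y) (All.lookup y> z∈))))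
  where
  ∈⇒≤ : ∀ {w z ws} → All (w >_) ws → z ∈ w ∷ ws → z ≤ w
  ∈⇒≤ w> (here refl) = ≤-refl
  ∈⇒≤ w> (there z∈)  = <⇒≤ (All.lookup w> z∈)
  x≡y : x ≡ y
  x≡y = ≤-antisym (∈⇒≤ y> (f (here refl))) (∈⇒≤ x> (g (here refl)))
  shrink : ∀ {z w} {ws : List ℕ} → z ∈ w ∷ ws → z ≢ w → z ∈ ws
  shrink (here z≡w) z≢w = ⊥-elim (z≢w z≡w)
  shrink (there z∈) z≢w = z∈

module _ {n k M : ℕ} (n≡ : n ≡ suc M + k) where

  n∸k≡ : n ∸ k ≡ suc M
  n∸k≡ = trans (cong (_∸ k) n≡) (m+n∸n≡m (suc M) k)

  letter-+ : ∀ {a b} → b ≤ n → letter n (a , b) + (b ∸ a) ≡ n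
  letter-+ {a} {b} b≤n = m∸n+n≡m (≤-trans (m∸n≤m b a) b≤n)

  -- The last bound is `proj₂ d ≤ n` rewritten; because of it, later rows leave the earlier
  -- positions alone.
  row-letter : ∀ {a d} → d ∈ row n k a → k < letter n d × letter n d ≤ M × a ≤ letter n d
  row-letter {a} {d} d∈ with refl , a<b , b≤n , k< , <n∸k ← ∈-row⁻ {n} {k} {a} d∈ =
    letter-bounds (letter n d) (proj₂ d ∸ a) a (subst (proj₂ d ∸ a <_) n∸k≡ <n∸k) k<
      (trans (letter-+ {a} {proj₂ d} b≤n) n≡)
      (≤-trans (≤-reflexive (m∸n+n≡m (<⇒≤ a<b))) (≤-trans b≤n (≤-reflexive n≡)))

  -- Diagonals become cells of a grid with coordinates row `r` and letter `ℓ`; the complement `e` of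
  -- `ℓ` in n is the length of the diagonal.
  cell-∈-row : ∀ {r ℓ e} → ℓ + e ≡ n → r ≤ ℓ → k < ℓ → ℓ ≤ M → (r , r + e) ∈ row n k r × letter n (r , r + e) ≡ ℓ
  cell-∈-row {r} {ℓ} {e} ℓ+e r≤ℓ k<ℓ ℓ≤M =
      ∈-row⁺ (≤-trans (≤-reflexive (+-comm 1 r)) (+-monoʳ-≤ r (≤-trans (s≤s z≤n) k<e)))
        (≤-trans (+-monoˡ-≤ e r≤ℓ) (≤-reflexive ℓ+e))
        (subst (k <_) (sym (m+n∸m≡n r e)) k<e)
        (subst₂ _<_ (sym (m+n∸m≡n r e)) (sym n∸k≡) (proj₂ bounds))
    , trans (cong (n ∸_) (m+n∸m≡n r e)) (trans (cong (_∸ e) (sym ℓ+e)) (m+n∸n≡m ℓ e))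
    where
    bounds = codiagonal-bounds ℓ e (trans ℓ+e n≡) k<ℓ ℓ≤M
    k<e = proj₁ bounds

  row-letters : ∀ a → map (letter n) (row n k a) ≡ filter (k <?_) (down M a)
  row-letters a = decreasing-≡ (AllPairs.map⁺ (row-letters-decreasing n k a))
    (AllPairs.filter⁺ (k <?_) (subst (AllPairs _>_) (sym (reverse-applyUpTo (a +_) (suc M ∸ a)))
      (AllPairs.applyDownFrom⁺₁ (a +_) _ (λ j<i _ → +-monoʳ-< a j<i))))
    to from
    where
    to : ∀ {x} → x ∈ map (letter n) (row n k a) → x ∈ filter (k <?_) (down M a)
    to x∈ with d , d∈ , refl ← ∈-map⁻ (letter n) x∈ with k<x , x≤M , a≤x ← row-letter d∈ =
      ∈-filter⁺ (k <?_) (reverse⁺ (∈-range⁺ a≤x x≤M)) k<x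
    from : ∀ {x} → x ∈ filter (k <?_) (down M a) → x ∈ map (letter n) (row n k a)
    from {x} x∈ with x∈′ , k<x ← ∈-filter⁻ (k <?_) {xs = down M a} x∈
      with a≤x , x≤M ← ∈-range⁻ {a} {M} (reverse⁻ x∈′)
      with c∈ , eq ← cell-∈-row {a} {x} {n ∸ x} (m+[n∸m]≡n (≤-trans x≤M (≤-trans (n≤1+n M) (≤-trans (m≤m+n (suc M) k) (≤-reflexive (sym n≡)))))) a≤x k<x x≤M
      = subst (_∈ map (letter n) (row n k a)) eq (∈-map⁺ (letter n) c∈)

  Q′word-letters : Q′word n k ≡ map (letter n) (Γ n k)
  Q′word-letters = begin
    filter (k <?_) (concat (map (down (n ∸ k ∸ 1)) (range 1 (n ∸ k ∸ 1)))) ≡⟨ cong (λ N → filter (k <?_) (concat (map (down N) (range 1 N)))) (cong (_∸ 1) n∸k≡) ⟩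
    filter (k <?_) (concat (map (down M) (range 1 M)))      ≡⟨ filter-concat (k <?_) (map (down M) (range 1 M)) ⟩
    concat (map (filter (k <?_)) (map (down M) (range 1 M))) ≡⟨ cong concat (map-∘ (range 1 M)) ⟨
    concat (map g (range 1 M))                              ≡⟨ ++-identityʳ _ ⟨
    -- Γ runs over n = `M + suc k` rows and Q over `M` blocks; the surplus `suc k` rows contribute
    -- no letters.
    concat (map g (range 1 M)) ++ []                        ≡⟨ cong (concat (map g (range 1 M)) ++_) (empty (suc k) (m≤m+n M)) ⟨
    concat (map g (range 1 M)) ++ concat (map g (applyUpTo (λ i → suc (M + i)) (suc k))) ≡⟨ concatMap-++ g (range 1 M) _ ⟨
    concat (map g (range 1 M ++ applyUpTo (λ i → suc (M + i)) (suc k))) ≡⟨ cong (λ l → concat (map g l)) (applyUpTo-+ suc M (suc k)) ⟨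
    concat (map g (range 1 (M + suc k)))                    ≡⟨ cong (λ N → concat (map g (range 1 N))) (trans (+-suc M k) (sym n≡)) ⟩
    concat (map g (range 1 n))                              ≡⟨ cong concat (map-cong row-letters (range 1 n)) ⟨
    concat (map (map (letter n) ∘ row n k) (range 1 n))     ≡⟨ cong concat (map-∘ (range 1 n)) ⟩
    concat (map (map (letter n)) (map (row n k) (range 1 n))) ≡⟨ concat-map (map (row n k) (range 1 n)) ⟩
    map (letter n) (Γ n k)                                  ∎
    where
    open ≡-Reasoning
    g : ℕ → List ℕ
    g = filter (k <?_) ∘ down M
    empty : ∀ m {f} → (∀ i → M ≤ f i) → concat (map g (applyUpTo (suc ∘ f) m)) ≡ []
    empty zero        M≤f = refl
    empty (suc m) {f} M≤f rewrite m≤n⇒m∸n≡0 (M≤f 0) = empty m (M≤f ∘ suc)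

-- Running a subword row by row.

AllPairs-split : ∀ {A : Set} {R : A → A → Set} xs {y ys} → AllPairs R (xs ++ y ∷ ys) → All (λ x → R x y) xs × All (R y) ys
AllPairs-split []       (y> ∷ _)   = [] , y>
AllPairs-split (x ∷ xs) (x> ∷ xs>) with y-last , y> ← AllPairs-split xs xs> = All.lookup x> (∈-insert xs) ∷ y-last , y>

-- choice d p tells whether the letter of d is used when the current permutation is p.
module Process {n k M : ℕ} (n≡ : n ≡ suc M + k) (choice : Diag → List ℕ → Bool) where

  step : List ℕ → Diag → List ℕ
  step p d = if choice d p then swapAt (letter n d) p else p

  run : List ℕ → List Diag → List ℕ
  run = foldl step

  state : ℕ → List ℕ
  state zero    = idPerm (suc M)
  state (suc r) = run (state r) (row n k (suc r))

  run-rows : ∀ r → run (idPerm (suc M)) (concat (map (row n k) (range 1 r))) ≡ state r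
  run-rows zero    = refl
  run-rows (suc r) = begin
    run (idPerm (suc M)) (concat (map (row n k) (range 1 (suc r))))       ≡⟨ cong (λ l → run (idPerm (suc M)) (concat (map (row n k) l))) (applyUpTo-∷ʳ suc r) ⟨
    run (idPerm (suc M)) (concat (map (row n k) (range 1 r ++ suc r ∷ []))) ≡⟨ cong (run (idPerm (suc M))) (concatMap-++ (row n k) (range 1 r) (suc r ∷ [])) ⟩
    run (idPerm (suc M)) (concat (map (row n k) (range 1 r)) ++ (row n k (suc r) ++ [])) ≡⟨ foldl-++ step (idPerm (suc M)) (concat (map (row n k) (range 1 r))) _ ⟩
    run (run (idPerm (suc M)) (concat (map (row n k) (range 1 r)))) (row n k (suc r) ++ []) ≡⟨ cong₂ run (run-rows r) (++-identityʳ (row n k (suc r))) ⟩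
    state (suc r) ∎
    where open ≡-Reasoning

  step-above : ∀ v p d j → j ≢ letter n d → above v (step p d) j ≡ above v p j
  step-above v p d j j≢ with choice d p
  ... | true  = above-swapAt v (letter n d) p j j≢
  ... | false = refl

  run-above : ∀ v p ds j → All (λ d → j ≢ letter n d) ds → above v (run p ds) j ≡ above v p j
  run-above v p []       j []        = refl
  run-above v p (d ∷ ds) j (j≢ ∷ js) = trans (run-above v (step p d) ds j js) (step-above v p d j j≢)

  step-length : ∀ p d → length (step p d) ≡ length p
  step-length p d with choice d p
  ... | true  = length-swapAt (letter n d) p
  ... | false = refl

  run-length : ∀ p ds → length (run p ds) ≡ length p
  run-length p []       = refl
  run-length p (d ∷ ds) = trans (run-length (step p d) ds) (step-length p d)

  step-sum : ∀ p d → sum (step p d) ≡ sum p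
  step-sum p d with choice d p
  ... | true  = sum-swapAt (letter n d) p
  ... | false = refl

  run-sum : ∀ p ds → sum (run p ds) ≡ sum p
  run-sum p []       = refl
  run-sum p (d ∷ ds) = trans (run-sum (step p d) ds) (step-sum p d)

  step-take : ∀ p d → k < letter n d → take k (step p d) ≡ take k p
  step-take p d k< with choice d p
  ... | true  = take-swapAt k (letter n d) p k<
  ... | false = refl

  run-take : ∀ p ds → All (λ d → k < letter n d) ds → take k (run p ds) ≡ take k p
  run-take p []       []        = refl
  run-take p (d ∷ ds) (k< ∷ ks) = trans (run-take (step p d) ds ks) (step-take p d k<)

  state-length : ∀ r → length (state r) ≡ suc M
  state-length zero    = length-applyUpTo suc (suc M)
  state-length (suc r) = trans (run-length (state r) (row n k (suc r))) (state-length r)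

  state-sum : ∀ r → sum (state r) ≡ sum (idPerm (suc M))
  state-sum zero    = refl
  state-sum (suc r) = trans (run-sum (state r) (row n k (suc r))) (state-sum r)

  state-take : ∀ r → take k (state r) ≡ take k (idPerm (suc M))
  state-take zero    = refl
  state-take (suc r) = trans (run-take (state r) (row n k (suc r)) (All.tabulate (λ d∈ → proj₁ (row-letter n≡ d∈)))) (state-take r)

  state-above-left : ∀ v r → above v (state r) k ≡ above v (idPerm (suc M)) k
  state-above-left v zero    = refl
  state-above-left v (suc r) = trans
    (run-above v (state r) (row n k (suc r)) k (All.tabulate (λ d∈ → <⇒≢ (proj₁ (row-letter n≡ d∈)))))
    (state-above-left v r)

  state-above-right : ∀ v r → above v (state r) (suc M) + suc M ≤ suc M
  state-above-right v r = +-monoˡ-≤ (suc M) (≤-trans (above-≤-length v (state r) (suc M))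
    (≤-reflexive (trans (cong (_∸ suc M) (state-length r)) (n∸n≡0 (suc M)))))

  state-above-length : ∀ v r ℓ → ℓ ≤ suc M → above v (state r) ℓ + ℓ ≤ suc M
  state-above-length v r ℓ ℓ≤ = ≤-trans (+-monoˡ-≤ ℓ (≤-trans (above-≤-length v (state r) ℓ)
    (≤-reflexive (cong (_∸ ℓ) (state-length r))))) (≤-reflexive (m∸n+n≡m ℓ≤))

  -- Letters of a row are at least its index, so no row after the `u`-th changes the count at `u`;
  -- the final permutation keeps the count reached in `state u`.
  state-above-after : ∀ v u t → above v (state (t + u)) u ≡ above v (state u) u
  state-above-after v u zero    = refl
  state-above-after v u (suc t) = trans
    (run-above v (state (t + u)) (row n k (suc (t + u))) u
      (All.tabulate (λ d∈ → <⇒≢ (≤-trans (s≤s (m≤n+m u t)) (proj₂ (proj₂ (row-letter n≡ d∈)))))))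
    (state-above-after v u t)

  -- Letters decrease along a row. When `d`, with letter `suc i`, has just been read, the larger
  -- letters of its row are done and the smaller ones pending: counts at `suc i` and beyond are
  -- already those of the new state, while the count at `i` is still the old one.
  record CellStep (r : ℕ) (d : Diag) (i : ℕ) : Set where
    field
      before     : List ℕ
      here-old   : ∀ v → above v before (suc i) ≡ above v (state r) (suc i)
      here-new   : ∀ v → above v (step before d) (suc i) ≡ above v (state (suc r)) (suc i)
      above-new  : ∀ v → above v (step before d) (suc (suc i)) ≡ above v (state (suc r)) (suc (suc i))
      below-old  : ∀ v → above v (step before d) i ≡ above v (state r) i

  cellStep : ∀ {r d i} → d ∈ row n k (suc r) → letter n d ≡ suc i → CellStep r d i
  cellStep {r} {d} {i} d∈ ℓ≡ with pre , post , row≡ ← ∈-∃++ d∈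
    with pre> , post< ← AllPairs-split pre (subst (AllPairs (_>_ on letter n)) row≡ (row-letters-decreasing n k (suc r)))
    = record
      { before    = before
      ; here-old  = λ v → run-above v (state r) pre (suc i) (All.map <⇒≢ pre>′)
      ; here-new  = λ v → sym (trans (cong (λ p → above v p (suc i)) split) (run-above v (step before d) post (suc i) (All.map >⇒≢ post<′)))
      ; above-new = λ v → sym (trans (cong (λ p → above v p (suc (suc i))) split) (run-above v (step before d) post (suc (suc i)) (All.map (>⇒≢ ∘ m<n⇒m<1+n) post<′)))
      ; below-old = λ v → trans (step-above v before d i (<⇒≢ (≤-reflexive (sym ℓ≡)))) (run-above v (state r) pre i (All.map (<⇒≢ ∘ <-trans (n<1+n i)) pre>′))
      }
    where
    pre>′ : All (λ x → suc i < letter n x) pre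
    pre>′ = All.map (λ {x} → subst (_< letter n x) ℓ≡) pre>
    post<′ : All (λ x → letter n x < suc i) post
    post<′ = All.map (λ {x} → subst (letter n x <_) ℓ≡) post<
    before : List ℕ
    before = run (state r) pre
    split : state (suc r) ≡ run (step before d) post
    split = trans (cong (run (state r)) row≡) (foldl-++ step (state r) pre (d ∷ post))

-- The greedy subword and chains in F.

greedy : ℕ → (Diag → Bool) → Diag → List ℕ → Bool
greedy n F d p = not (F d) ∧ ascent (letter n d) p

module Threshold {n k M : ℕ} (n≡ : n ≡ suc M + k) (choice : Diag → List ℕ → Bool)
                 {u w : ℕ} (u+w≡n : u + w ≡ n) (k≤u : k ≤ u) (u≤ : u ≤ suc M) where

  open Process {n} {k} {M} n≡ choice

  height : ℕ → ℕ → ℕ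
  height r ℓ = above (suc w) (state r) ℓ

  total : u + w ≡ suc M + k
  total = trans u+w≡n n≡

  -- Exactly `u − k` of the values 1 , ... , `suc M` exceed `w`, and in the identity all of them sit
  -- past position `w`.
  height-bottom : ∀ {ℓ} → ℓ ≤ w → height 0 ℓ + k ≡ u
  height-bottom {ℓ} ℓ≤w = boundary-height {w = w} {M = M}
    (trans (cong (_+ w) (above-idPerm (suc M) w ℓ ℓ≤w)) (m∸n+n≡m (opposite-≤ total k≤u))) total

  -- All letters exceed `k`, so no swap moves an entry across the border between positions `k` and
  -- `k + 1`.
  height-left : ∀ r → height r k + k ≡ u
  height-left r = trans (cong (_+ k) (state-above-left (suc w) r)) (height-bottom (opposite-≥ total u≤))

  height-bottom-≤ : ∀ {ℓ} → k ≤ ℓ → height 0 ℓ + k ≤ u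
  height-bottom-≤ k≤ℓ = ≤-trans (+-monoˡ-≤ k (above-antitone (suc w) (state 0) k≤ℓ)) (≤-reflexive (height-left 0))

_≪_ : Diag → Diag → Set
d ≪ d′ = proj₁ d < proj₁ d′ × proj₂ d < proj₂ d′

module Greedy {n k M : ℕ} (n≡ : n ≡ suc M + k) (F : Diag → Bool)
              {u w : ℕ} (u+w≡n : u + w ≡ n) (k≤u : k ≤ u) (u≤ : u ≤ suc M) where

  open Process {n} {k} {M} n≡ (greedy n F)
  open Threshold {n} {k} {M} n≡ (greedy n F) u+w≡n k≤u u≤

  step-F : ∀ p d → F d ≡ true → step p d ≡ p
  step-F p d Fd rewrite Fd = refl

  step-¬F : ∀ p d → F d ≡ false → ascent (letter n d) (step p d) ≡ false
  step-¬F p d Fd rewrite Fd with ascent (letter n d) p in asc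
  ... | true  = ascent-swapAt (letter n d) p asc
  ... | false = asc

  -- The largest diagonal comes first. As soon as `r ≤ u`, all starts are ≤ `u` and all ends > `u`,
  -- so that any two members cross.
  Chain : ℕ → ℕ → ℕ → Set
  Chain r b c = Σ (List Diag) λ L → length L ≡ c
    × All (λ d → F d ≡ true × proj₁ d ≤ r × proj₂ d ≤ b × u < proj₂ d) L
    × AllPairs (λ d d′ → d′ ≪ d) L

  weaken : ∀ {r r′ b b′ c} → r ≤ r′ → b ≤ b′ → Chain r b c → Chain r′ b′ c
  weaken r≤ b≤ (L , len , bounds , chain) =
    L , len , All.map (λ (Fd , a≤ , b′≤ , u<) → Fd , ≤-trans a≤ r≤ , ≤-trans b′≤ b≤ , u<) bounds , chain

  -- If the diagonal is outside F, the greedy rule leaves no ascent at its letter, and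
  -- `above-nonascent` applies at that moment; `CellStep` then expresses its counts through the
  -- states of the two rows. The three cases are the three terms of the maximum.
  cell-recursion : ∀ {r e i} → suc i + e ≡ n → suc r ≤ suc i → k < suc i → suc i ≤ M →
    (F (suc r , suc r + e) ≡ true × height (suc r) (suc i) ≡ height r (suc i))
    ⊎ height (suc r) (suc i) ≡ height (suc r) (suc (suc i))
    ⊎ height r i ≡ suc (height (suc r) (suc i))
  cell-recursion {r} {e} {i} ℓ+e r≤ k< ℓ≤M = by-membership (F d) refl
    where
    d : Diag
    d = suc r , suc r + e
    cell : d ∈ row n k (suc r) × letter n d ≡ suc i
    cell = cell-∈-row {n} {k} {M} n≡ ℓ+e r≤ k< ℓ≤M
    open CellStep (cellStep (proj₁ cell) (proj₂ cell))
    by-membership : ∀ b → F d ≡ b →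
      (F d ≡ true × height (suc r) (suc i) ≡ height r (suc i))
      ⊎ height (suc r) (suc i) ≡ height (suc r) (suc (suc i))
      ⊎ height r i ≡ suc (height (suc r) (suc i))
    by-membership true  Fd = inj₁ (Fd , trans (sym (here-new (suc w)))
      (trans (cong (λ p → above (suc w) p (suc i)) (step-F before d Fd)) (here-old (suc w))))
    by-membership false Fd = inj₂ (Sum.map
      (λ eq → trans (sym (here-new (suc w))) (trans eq (above-new (suc w))))
      (λ eq → trans (sym (below-old (suc w))) (trans eq (cong suc (here-new (suc w)))))
      (above-nonascent (suc w) i (step before d) (subst (λ ℓ → ascent ℓ (step before d) ≡ false) (proj₂ cell) (step-¬F before d Fd))))

  add : ∀ {r e c} → F (suc r , suc r + e) ≡ true → u < suc r + e → Chain r (r + e) c → Chain (suc r) (suc r + e) (suc c)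
  add {r} {e} Fd u< (L , len , bounds , chain) = (suc r , suc r + e) ∷ L , cong suc len
    , (Fd , ≤-refl , ≤-refl , u<) ∷ All.map (λ (Fd , a≤ , b≤ , u<) → Fd , m≤n⇒m≤1+n a≤ , m≤n⇒m≤1+n b≤ , u<) bounds
    , All.map (λ (_ , a≤ , b≤ , _) → s≤s a≤ , s≤s b≤) bounds ∷ chain

  -- Backtracking through height r ℓ + r, which satisfies the recursion of a longest chain ending in the cell (r , r + e).
  trace : ∀ r e ℓ c → ℓ + e ≡ n → r ≤ ℓ → k ≤ ℓ → ℓ ≤ suc M → 1 ≤ height r ℓ →
    u + c ≤ height r ℓ + r + k → r + k + 1 ≤ c + ℓ → Chain r (r + e) c
  trace r e ℓ zero ℓ+e r≤ k≤ ℓ≤ h≥1 h₁ h₂ = [] , refl , [] , []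
  trace r e ℓ (suc c) ℓ+e r≤ k≤ ℓ≤ h≥1 h₁ h₂ with m≤n⇒m<n∨m≡n k≤ | m≤n⇒m<n∨m≡n ℓ≤
  -- The borders are impossible while a diagonal is still wanted. At letter `k` the height is
  -- `u − k`, so the first inequality gives `suc c ≤ r` and the second `r ≤ c`; at letter `suc M`
  -- the height is 0; in row 0 it is at most `u − k`.
  ... | inj₂ refl | _ = ⊥-elim (trace-left {u} {c} {height r k} {r} (height-left r) h₁ h₂)
  ... | inj₁ _    | inj₂ refl = ⊥-elim (trace-right {height r (suc M)} {M} h≥1 (state-above-right (suc w) r))
  trace zero e ℓ (suc c) ℓ+e r≤ k≤ ℓ≤ h≥1 h₁ h₂ | inj₁ _ | inj₁ _ =
    ⊥-elim (trace-bottom {u} {c} {height 0 ℓ} {k} (height-bottom-≤ k≤) h₁)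
  trace (suc r) zero ℓ (suc c) ℓ+e r≤ k≤ ℓ≤ h≥1 h₁ h₂ | inj₁ k<ℓ | inj₁ (s≤s ℓ≤M) =
    ⊥-elim (n≮0 (proj₁ (codiagonal-bounds {k} {M} ℓ 0 (trans ℓ+e n≡) k<ℓ ℓ≤M)))
  trace (suc r) (suc e) (suc i) (suc c) ℓ+e r≤ k≤ ℓ≤ h≥1 h₁ h₂ | inj₁ k<ℓ | inj₁ (s≤s ℓ≤M)
    with cell-recursion {r} {suc e} {i} ℓ+e r≤ k<ℓ ℓ≤M
  -- The diagonal is taken. Only `suc M − ℓ`, that is its length minus `k`, positions lie past its
  -- letter `ℓ`; this bounds the height, and the first inequality then puts the end of the diagonal
  -- past `u`.
  ... | inj₁ (Fd , h≡) = add Fd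
    (trace-separated {u} {c} {height (suc r) (suc i)} {suc r} {k} {suc i} {suc e} {M} h₁ (state-above-length (suc w) (suc r) (suc i) ℓ≤) (trans ℓ+e n≡))
    (trace r (suc e) (suc i) c ℓ+e (<⇒≤ r≤) k≤ ℓ≤
      (subst (1 ≤_) h≡ h≥1)
      (trace-gain {u} {c} {height r (suc i)} {r} {k} (subst (λ h → u + suc c ≤ h + suc r + k) h≡ h₁))
      (trace-gain′ {c} {r} {k} h₂))
  -- The next larger letter in the same row: the bound on the ends drops by one.
  ... | inj₂ (inj₁ h≡) = weaken ≤-refl (+-monoʳ-≤ (suc r) (n≤1+n e))
    (trace (suc r) e (suc (suc i)) (suc c) (trans (sym (+-suc (suc i) e)) ℓ+e) (m≤n⇒m≤1+n r≤) (m≤n⇒m≤1+n k≤) (s≤s ℓ≤M)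
      (subst (1 ≤_) h≡ h≥1)
      (subst (λ h → u + suc c ≤ h + suc r + k) h≡ h₁)
      (trace-up {suc c} {suc r} h₂))
  -- The previous row with the bound on the ends unchanged: the height gained pays for the row lost.
  ... | inj₂ (inj₂ h≡) = weaken (n≤1+n r) (≤-reflexive (+-suc r (suc e)))
    (trace r (suc (suc e)) i (suc c) (trans (+-suc i (suc e)) ℓ+e) (≤-pred r≤) (≤-pred k<ℓ) (≤-trans (n≤1+n i) ℓ≤)
      (subst (1 ≤_) (sym h≡) (s≤s z≤n))
      (subst (λ h → u + suc c ≤ h + r + k) (sym h≡) (trace-diagonal {u} {suc c} {height (suc r) (suc i)} {r} {k} h₁))
      (trace-diagonal′ {suc c} {r} {k} h₂))

  -- Backtracking starts in row `u` at letter `u`, where the bound on the ends is n. With target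
  -- `suc k`, a positive height is exactly the first inequality of `trace`, and the second is an
  -- equality.
  crossing : 1 ≤ height u u → Σ (List Diag) λ L → length L ≡ suc k × All (λ d → F d ≡ true) L × AllPairs Crosses L
  crossing h≥1 with L , len , bounds , chain ← trace u w u (suc k) u+w≡n ≤-refl k≤u u≤ h≥1 (trace-start {u} h≥1) (trace-start′ u k)
    = L , len , All.map proj₁ bounds , crosses bounds chain
    where
    crosses : ∀ {b L} → All (λ d → F d ≡ true × proj₁ d ≤ u × proj₂ d ≤ b × u < proj₂ d) L →
      AllPairs (λ d d′ → d′ ≪ d) L → AllPairs Crosses L
    crosses [] [] = []
    crosses ((_ , a≤u , _) ∷ bounds) (chain ∷ chains) =
      All.zipWith (λ ((a′<a , b′<b) , (_ , _ , _ , u<b′)) → inj₂ (a′<a , ≤-<-trans a≤u u<b′ , b′<b)) (chain , bounds)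
      ∷ crosses bounds chains

-- Chains bound heights for every subword avoiding F.

module Avoiding {n k M : ℕ} (n≡ : n ≡ suc M + k) (choice : Diag → List ℕ → Bool) (F : Diag → Bool)
                (avoids : ∀ d p → F d ≡ true → choice d p ≡ false)
                {u w : ℕ} (u+w≡n : u + w ≡ n) (k≤u : k ≤ u) (u≤ : u ≤ suc M) where

  open Process {n} {k} {M} n≡ choice
  open Threshold {n} {k} {M} n≡ choice u+w≡n k≤u u≤

  step-F : ∀ p d → F d ≡ true → step p d ≡ p
  step-F p d Fd rewrite avoids d p Fd = refl

  -- Right after the letter `suc i` of row `suc r`, the count at `i` is old and the count at `suc i`
  -- new; neighbouring counts differ by at most one.
  height-diagonal : ∀ {r i} → suc r ≤ suc i → k < suc i → suc i ≤ M → height r i ≤ suc (height (suc r) (suc i))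
  height-diagonal {r} {i} r≤ k< ℓ≤M = subst₂ (λ x y → x ≤ suc y) (below-old (suc w)) (here-new (suc w)) (above-≤-suc (suc w) (step before (suc r , suc r + e)) i)
    where
    e : ℕ
    e = n ∸ suc i
    ℓ+e : suc i + e ≡ n
    ℓ+e = m+[n∸m]≡n (≤-trans ℓ≤M (≤-trans (n≤1+n M) (≤-trans (m≤m+n (suc M) k) (≤-reflexive (sym n≡)))))
    cell : (suc r , suc r + e) ∈ row n k (suc r) × letter n (suc r , suc r + e) ≡ suc i
    cell = cell-∈-row {n} {k} {M} n≡ ℓ+e r≤ k< ℓ≤M
    open CellStep (cellStep (proj₁ cell) (proj₂ cell))

  -- The last hypothesis compares the ends of the two cells' diagonals. Stepping back from `(r , ℓ)`
  -- to `(r − 1 , ℓ − 1)` never raises height plus row, by `height-diagonal`. The walk stops in row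
  -- `s`, where counts fall along the row, or at letter `k`, where the count is the same in all
  -- rows.
  height-mono : ∀ r s {ℓ ℓ′} → s ≤ r → r ≤ ℓ → k ≤ ℓ → ℓ ≤ M → k ≤ ℓ′ → s + ℓ ≤ r + ℓ′ → height s ℓ′ + s ≤ height r ℓ + r
  height-mono r s {ℓ} {ℓ′} s≤r r≤ k≤ ℓ≤ k≤′ cone with m≤n⇒m<n∨m≡n s≤r | m≤n⇒m<n∨m≡n k≤
  ... | inj₂ refl | _ = +-monoˡ-≤ s (above-antitone (suc w) (state s) (+-cancelˡ-≤ s _ _ cone))
  ... | inj₁ _ | inj₂ refl = +-mono-≤ (≤-trans (above-antitone (suc w) (state s) k≤′)
      (≤-reflexive (trans (state-above-left (suc w) s) (sym (state-above-left (suc w) r))))) s≤r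
  height-mono (suc r) s {suc i} {ℓ′} s≤r r≤ k≤ ℓ≤ k≤′ cone | inj₁ (s≤s s≤r′) | inj₁ k<ℓ =
    mono-step (height-mono r s s≤r′ (≤-pred r≤) (≤-pred k<ℓ) (<⇒≤ ℓ≤) k≤′ (mono-diagonal {s} {i} {r} cone)) (height-diagonal r≤ k<ℓ ℓ≤)

  -- Every diagonal of a chain in F raises height plus row by one, since its letter is skipped and
  -- the height there stays put while the row advances; between diagonals `height-mono` prevents any
  -- loss.
  chain-height : ∀ L r ℓ → r ≤ ℓ → k ≤ ℓ → ℓ ≤ M → u + ℓ ≤ r + n →
    All (λ d → F d ≡ true × d ∈ row n k (proj₁ d) × 1 ≤ proj₁ d × u < proj₂ d) L → AllPairs (λ d d′ → d′ ≪ d) L →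
    All (λ d → proj₁ d ≤ r × proj₂ d + ℓ ≤ r + n) L →
    u + length L ≤ height r ℓ + r + k
  chain-height [] r ℓ r≤ k≤ ℓ≤ u≤′ [] [] [] =
    -- The empty chain is compared with row 0 at letter `w`, where the height is `u − k`.
    chain-base {u} {height 0 w} {height r ℓ} {r} {k} (height-bottom ≤-refl) (height-mono r 0 z≤n r≤ k≤ ℓ≤ (opposite-≥ total u≤) (chain-base′ {u} {ℓ} {r} {w} u+w≡n u≤′))
  chain-height ((suc a , b) ∷ L) r ℓ r≤ k≤ ℓ≤ u≤′ ((Fd , d∈ , _ , u<b) ∷ L∈) (d> ∷ chain) ((a≤r , b≤) ∷ _)
    with _ , a<b , b≤n , _ ← ∈-row⁻ {n} {k} d∈
    with k<x , x≤M , a≤x ← row-letter {n} {k} {M} n≡ d∈ =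
    chain-step {u} {length L} {height a x} {height r ℓ} {a} {r} {k}
      -- The rest of the chain is measured at the same letter one row earlier: its starts are at
      -- most `a` and its ends at most `b − 1`.
      (chain-height L a x (<⇒≤ a≤x) (<⇒≤ k<x) x≤M (cone u<b) L∈ chain
        (All.map (λ (a′<a , b′<b) → ≤-pred a′<a , cone b′<b) d>))
      (subst (λ h → h + suc a ≤ height r ℓ + r) h≡ (height-mono r (suc a) a≤r r≤ k≤ ℓ≤ (<⇒≤ k<x) (chain-cone {suc a} {b} {x} {b ∸ suc a} b≤ x+δ δ+a)))
    where
    x : ℕ
    x = letter n (suc a , b)
    x+δ : x + (b ∸ suc a) ≡ n
    x+δ = letter-+ {n} {k} {M} n≡ {suc a} {b} b≤n
    δ+a : b ∸ suc a + suc a ≡ b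
    δ+a = m∸n+n≡m (<⇒≤ a<b)
    cone : ∀ {c} → c < b → c + x ≤ a + n
    cone c<b = chain-cone′ {a} {b} {_} {x} {b ∸ suc a} c<b x+δ δ+a
    h≡ : height (suc a) x ≡ height a x
    h≡ = height-F x refl
      where
      height-F : ∀ y → x ≡ y → height (suc a) y ≡ height a y
      height-F zero    eq = ⊥-elim (n≮0 (subst (k <_) eq k<x))
      height-F (suc i) eq = trans (sym (here-new (suc w))) (trans (cong (λ p → above (suc w) p (suc i)) (step-F before _ Fd)) (here-old (suc w)))
        where open CellStep (cellStep d∈ eq)

-- Subsets of positions and subwords.

inversions-increasing : ∀ {p} → AllPairs _<_ p → inversions p ≡ 0
inversions-increasing []                  = refl
inversions-increasing {x ∷ p} (x< ∷ p<) =
  cong₂ _+_ (cong length (filter-none (_<? x) (All.map <⇒≯ x<))) (inversions-increasing p<)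

inversions-idPerm : ∀ N → inversions (idPerm N) ≡ 0
inversions-idPerm N = inversions-increasing (AllPairs.applyUpTo⁺₁ suc N (λ i<j _ → s≤s i<j))

Γ-unique : ∀ n k → Unique (Γ n k)
Γ-unique n k = AllPairs.concat⁺
  (All.map⁺ (All.tabulate (λ {a} _ → AllPairs.map (λ { gt refl → <-irrefl refl gt }) (row-letters-decreasing n k a))))
  (AllPairs.map⁺ (AllPairs.applyUpTo⁺₁ suc n (λ {i} {j} i<j _ →
    All.tabulate (λ d∈ → All.tabulate (λ d′∈ eq → <⇒≢ (s≤s i<j)
      (trans (sym (proj₁ (∈-row⁻ {n} {k} {suc i} d∈))) (trans (cong proj₁ eq) (proj₁ (∈-row⁻ {n} {k} {suc j} d′∈)))))))))

∈-Γ⁻ : ∀ {n k d} → d ∈ Γ n k → d ∈ row n k (proj₁ d) × 1 ≤ proj₁ d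
∈-Γ⁻ {n} {k} {d} d∈ with xs , d∈xs , xs∈ ← ∈-concat⁻′ (map (row n k) (range 1 n)) d∈
  with a , a∈ , refl ← ∈-map⁻ (row n k) xs∈
  with refl ← proj₁ (∈-row⁻ {n} {k} {a} d∈xs) = d∈xs , proj₁ (∈-range⁻ {1} {n} a∈)

_≟ᵈ_ : DecidableEquality Diag
_≟ᵈ_ = Product.≡-dec _≟_ _≟_

-- Subsets of positions in a list of diagonals, read as predicates on the diagonals themselves.
tag : ∀ {m} → List Diag → Subset m → Diag → Bool
tag []       _       d = false
tag (x ∷ xs) []      d = false
tag (x ∷ xs) (b ∷ G) d with x ≟ᵈ d
... | yes _ = b
... | no  _ = tag xs G d

-- The length is a separate `m` because `G` may also be a subset of letter positions, whose number
-- agrees with that of the diagonals only up to a proof.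
tag-lookup : ∀ {m} xs (G : Subset m) (eq : length xs ≡ m) → Unique xs → ∀ i → tag xs G (lookup xs i) ≡ Vec.lookup G (cast eq i)
tag-lookup (x ∷ xs) (b ∷ G) eq (x≢ ∷ xs!) Fin.zero with x ≟ᵈ x
... | yes _  = refl
... | no x≢x = ⊥-elim (x≢x refl)
tag-lookup (x ∷ xs) (b ∷ G) eq (x≢ ∷ xs!) (Fin.suc i) with x ≟ᵈ lookup xs i
... | yes x≡ = ⊥-elim (All.lookup x≢ (∈-lookup i) x≡)
... | no  _  = tag-lookup xs G (suc-injective eq) xs! i

tag-true : ∀ {m} xs (G : Subset m) (eq : length xs ≡ m) {d} → tag xs G d ≡ true → ∃ λ i → lookup xs i ≡ d × Vec.lookup G (cast eq i) ≡ true
tag-true (x ∷ xs) (b ∷ G) eq {d} t with x ≟ᵈ d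
... | yes x≡d = Fin.zero , x≡d , t
... | no  _   with i , l , g ← tag-true xs G (suc-injective eq) t = Fin.suc i , l , g

lookup-all : ∀ {xs : List Diag} {P : Fin (length xs) → Set} {L} → All (λ d → ∃ λ i → lookup xs i ≡ d × P i) L →
  ∃ λ I → map (lookup xs) I ≡ L × All P I
lookup-all []                        = [] , refl , []
lookup-all {xs} ((i , refl , p) ∷ ps) with I , refl , Is ← lookup-all {xs} ps = i ∷ I , refl , p ∷ Is

apply : List ℕ → List ℕ → List ℕ
apply = foldl (λ p i → swapAt i p)

module Words {n k M : ℕ} (n≡ : n ≡ suc M + k) where

  module _ (choice : Diag → List ℕ → Bool) where
    open Process {n} {k} {M} n≡ choice

    chosen : ∀ xs → List ℕ → Subset (length (map (letter n) xs))
    chosen []       p = []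
    chosen (d ∷ xs) p = choice d p ∷ chosen xs (step p d)

    apply-chosen : ∀ xs p → apply p (subword (map (letter n) xs) (chosen xs p)) ≡ run p xs
    apply-chosen []       p = refl
    apply-chosen (d ∷ xs) p with choice d p
    ... | true  = apply-chosen xs (swapAt (letter n d) p)
    ... | false = apply-chosen xs p

    lookup-chosen : ∀ xs p (eq : length xs ≡ length (map (letter n) xs)) i → Vec.lookup (chosen xs p) (cast eq i) ≡ true →
      ∃ λ q → choice (lookup xs i) q ≡ true
    lookup-chosen (d ∷ xs) p eq Fin.zero    t = p , t
    lookup-chosen (d ∷ xs) p eq (Fin.suc i) t = lookup-chosen xs (step p d) (suc-injective eq) i t

    -- Each used letter swaps an ascent and so adds one inversion. Starting from the identity, this
    -- shows that the greedy subword is reduced.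
    inversions-chosen : (∀ d p → choice d p ≡ true → ascent (letter n d) p ≡ true) →
      ∀ xs p → inversions (run p xs) ≡ length (subword (map (letter n) xs) (chosen xs p)) + inversions p
    inversions-chosen asc []       p = refl
    inversions-chosen asc (d ∷ xs) p with choice d p in c
    ... | false = inversions-chosen asc xs p
    ... | true  = trans (inversions-chosen asc xs (swapAt (letter n d) p))
                        (trans (cong (length (subword (map (letter n) xs) (chosen xs (swapAt (letter n d) p))) +_)
                                     (inversions-swapAt (letter n d) p (asc d p c)))
                               (+-suc _ (inversions p)))

  -- A subword given in advance is a choice that ignores the current permutation.
  apply-subword : ∀ (t : Diag → Bool) xs (G : Subset (length (map (letter n) xs))) (eq : length xs ≡ length (map (letter n) xs)) p →
    (∀ i → t (lookup xs i) ≡ Vec.lookup G (cast eq i)) →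
    apply p (subword (map (letter n) xs) G) ≡ Process.run {n} {k} {M} n≡ (λ d _ → t d) p xs
  apply-subword t []       []      eq p t≡ = refl
  apply-subword t (d ∷ xs) (b ∷ G) eq p t≡ with t d | t≡ Fin.zero
  ... | true  | refl = apply-subword t xs G (suc-injective eq) (swapAt (letter n d) p) (t≡ ∘ Fin.suc)
  ... | false | refl = apply-subword t xs G (suc-injective eq) p (t≡ ∘ Fin.suc)

-- Crossings as chains.

descending : DecTotalOrder _ _ _
descending = On.decTotalOrder (Flip.decTotalOrder ≤-decTotalOrder) (proj₁ {A = ℕ} {B = λ _ → ℕ})

Crosses-sym : ∀ {d e} → Crosses d e → Crosses e d
Crosses-sym (inj₁ c) = inj₂ c
Crosses-sym (inj₂ c) = inj₁ c

-- Of two crossing diagonals, the one with the smaller start has the smaller end, and this end lies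
-- past the larger start. Sorting by start thus gives a chain in which every later end exceeds the
-- largest start.
sort-crossing : ∀ L → AllPairs Crosses L → ∃ λ L′ → L′ ↭ L × AllPairs (λ d e → e ≪ d × proj₁ d < proj₂ e) L′
sort-crossing L cross = sort L , sort-↭ L , AllPairs.zipWith order
    ( Permutation.AllPairs-resp-↭ (setoid Diag) (λ {d} {e} → Crosses-sym {d} {e}) (resp₂ Crosses) (↭⇒↭ₛ (↭-sym (sort-↭ L))) cross
    , Sorted.Sorted⇒AllPairs (DecTotalOrder.totalOrder descending) (sort-↗ L))
  where
  open Sort descending
  order : ∀ {d e} → Crosses d e × proj₁ e ≤ proj₁ d → e ≪ d × proj₁ d < proj₂ e
  order (inj₁ (a<c , _) , c≤a)         = ⊥-elim (<⇒≱ a<c c≤a)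
  order (inj₂ (c<a , a<d , d<b) , _)   = (c<a , d<b) , a<d

-- The starts are distinct positive integers. For `suc k` diagonals the largest start exceeds `k`
-- and can therefore serve as the threshold `u`.
chain-length : ∀ d L → 1 ≤ proj₁ d → All (λ e → 1 ≤ proj₁ e) L → AllPairs (λ d e → e ≪ d) (d ∷ L) → suc (length L) ≤ proj₁ d
chain-length d []      1≤ []         _                               = 1≤
chain-length d (e ∷ L) 1≤ (1≤e ∷ 1≤L) (((e<d , _) ∷ _) ∷ chain) = ≤-trans (s≤s (chain-length e L 1≤e 1≤L chain)) e<d

-- The two implications between faces.

module Main {n k m : ℕ} (n≡ : n ≡ suc (k + m) + k) where

  M : ℕ
  M = k + m

  π : List ℕ
  π = idPerm k ++ decreasing k (suc m)

  N≡ : n ∸ k ≡ k + suc m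
  N≡ = trans (n∸k≡ {n} {k} {M} n≡) (sym (+-suc k m))

  πperm≡π : πperm n k ≡ π
  πperm≡π = trans (cong (λ N → range 1 k ++ reverse (range (suc k) N)) N≡) (π-split k (suc m))

  evalWord≡apply : ∀ v → evalWord (n ∸ k) v ≡ apply (idPerm (suc M)) v
  evalWord≡apply v = cong (λ N → apply (idPerm N) v) (n∸k≡ {n} {k} {M} n≡)

  word : List ℕ
  word = map (letter n) (Γ n k)

  len : length (Γ n k) ≡ length word
  len = sym (length-map (letter n) (Γ n k))

  σ : Fin (length (Γ n k)) ↔ Fin (length word)
  σ = mk↔ₛ′ (cast len) (cast (sym len)) (cast-involutive len (sym len)) (cast-involutive (sym len) len)

  module _ (F : Subset (length (Γ n k))) where

    inF : Diag → Bool
    inF = tag (Γ n k) F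

    inF-lookup : ∀ i → inF (lookup (Γ n k) i) ≡ Vec.lookup F i
    inF-lookup i = trans (tag-lookup (Γ n k) F refl (Γ-unique n k) i) (cong (Vec.lookup F) (cast-is-id refl i))

    inF-true : ∀ {d} → inF d ≡ true → ∃ λ i → lookup (Γ n k) i ≡ d × i Subset.∈ F
    inF-true {d} t with i , l , f ← tag-true (Γ n k) F refl t = i , l , lookup⇒[]= i F (trans (cong (Vec.lookup F) (sym (cast-is-id refl i))) f)

    lookup-image : ∀ x → Vec.lookup (imageSubset σ F) x ≡ Vec.lookup F (cast (sym len) x)
    lookup-image = lookup∘tabulate _

    face⇒subword : IsFaceΔ n k F → IsFaceSubword (n ∸ k) word (πperm n k) (imageSubset σ F)
    face⇒subword face = G , G⊆ , trans (evalWord≡apply (subword word G)) (trans (apply-chosen choice (Γ n k) (idPerm (suc M))) (trans final≡π (sym πperm≡π))) , lengths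
      where
      choice : Diag → List ℕ → Bool
      choice = greedy n inF
      open Words {n} {k} {M} n≡
      open Process {n} {k} {M} n≡ choice
      G : Subset (length word)
      G = chosen choice (Γ n k) (idPerm (suc M))
      G⊆ : G ⊆ ∁ (imageSubset σ F)
      G⊆ {x} x∈G = x∉p⇒x∈∁p λ x∈ → disjoint (lookup-chosen choice (Γ n k) (idPerm (suc M)) len i
          (trans (cong (Vec.lookup G) (cast-involutive len (sym len) x)) ([]=⇒lookup x∈G)))
        (trans (inF-lookup i) (trans (sym (lookup-image x)) ([]=⇒lookup x∈)))
        where
        i : Fin (length (Γ n k))
        i = cast (sym len) x
        disjoint : (∃ λ q → choice (lookup (Γ n k) i) q ≡ true) → inF (lookup (Γ n k) i) ≡ true → ⊥
        disjoint (q , c) f rewrite f with () ← c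
      ascents : ∀ d p → choice d p ≡ true → ascent (letter n d) p ≡ true
      ascents d p c with inF d
      ... | false = c
      final≡ : run (idPerm (suc M)) (Γ n k) ≡ state n
      final≡ = run-rows n
      uncrossed : ∀ i j → i + j ≡ suc m → above (suc (k + j)) (state n) (k + i) ≡ 0
      -- The count is inspected after row `k + i`: a zero there survives to the end, and a positive
      -- value yields a crossing inside F.
      uncrossed i j i+j with above (suc (k + j)) (state (k + i)) (k + i) in h≡
      ... | zero  = trans (trans (cong (λ t → above (suc (k + j)) (state t) (k + i)) (sym (trans (+-comm (k + j) (k + i)) u+w≡n)))
                            (state-above-after (suc (k + j)) (k + i) (k + j))) h≡
        where
        u+w≡n : k + i + (k + j) ≡ n
        u+w≡n = trans (opposite-sum {k} i j i+j) (sym n≡)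
      ... | suc h with L , L-length , L∈ , cross ← Greedy.crossing {n} {k} {M} n≡ inF {k + i} {k + j} (trans (opposite-sum {k} i j i+j) (sym n≡)) (m≤m+n k i)
                        (≤-trans (+-monoʳ-≤ k (≤-trans (m≤m+n i j) (≤-reflexive i+j))) (≤-reflexive (+-suc k m)))
                        (subst (1 ≤_) (sym h≡) (s≤s z≤n))
                  with I , refl , I∈ ← lookup-all {Γ n k} {λ i → i Subset.∈ F} (All.map inF-true L∈)
        = ⊥-elim (face (I , trans (sym (length-map (lookup (Γ n k)) I)) L-length , I∈ , AllPairs.map⁻ cross))
      final≡π : run (idPerm (suc M)) (Γ n k) ≡ π
      final≡π = trans final≡ (≡-π k (suc m) (state n) (trans (state-length n) (sym (+-suc k m)))
        (trans (state-take n) (cong (λ N → take k (idPerm N)) (sym (+-suc k m))))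
        (trans (state-sum n) (cong (sum ∘ idPerm) (sym (+-suc k m))))
        uncrossed)
      lengths : length (subword word G) ≡ inversions (πperm n k)
      lengths = sym (trans (cong inversions (trans πperm≡π (sym final≡π)))
        (trans (inversions-chosen choice ascents (Γ n k) (idPerm (suc M)))
          (trans (cong (length (subword word G) +_) (inversions-idPerm (suc M))) (+-identityʳ _))))

    -- The largest start in the crossing is the threshold `u`. The `k + 1` diagonals then force a
    -- positive count at `u`, which persists to the end of the word, whereas the corresponding count
    -- of π is zero.
    subword⇒face : IsFaceSubword (n ∸ k) word (πperm n k) (imageSubset σ F) → IsFaceΔ n k F
    subword⇒face (G , G⊆ , evalG , _) (I , I-length , I∈ , cross)
      with sort-crossing (map (lookup (Γ n k)) I) (AllPairs.map⁺ cross)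
    ... | [] , L↭ , _ with () ← trans (sym I-length) (trans (sym (length-map (lookup (Γ n k)) I)) (sym (↭-length L↭)))
    ... | (d ∷ L) , L↭ , chain@(d> ∷ _) = 1+n≰n {0} (≤-trans positive (≤-reflexive zero-height))
      where
      inG : Diag → Bool
      inG = tag (Γ n k) G
      inG-lookup : ∀ i → inG (lookup (Γ n k) i) ≡ Vec.lookup G (cast len i)
      inG-lookup = tag-lookup (Γ n k) G len (Γ-unique n k)
      avoids : ∀ d (p : List ℕ) → inF d ≡ true → inG d ≡ false
      avoids d p f with i , refl , i∈F ← inF-true f = trans (inG-lookup i) (¬-not λ g →
        x∈∁p⇒x∉p (G⊆ (lookup⇒[]= (cast len i) G g))
          (lookup⇒[]= (cast len i) (imageSubset σ F)
            (trans (lookup-image (cast len i)) (trans (cong (Vec.lookup F) (cast-involutive (sym len) len i)) ([]=⇒lookup i∈F)))))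
      open Process {n} {k} {M} n≡ (λ d _ → inG d)
      final≡π : state n ≡ π
      final≡π = trans (sym (run-rows n)) (trans (sym (Words.apply-subword {n} {k} {M} n≡ inG (Γ n k) G len (idPerm (suc M)) inG-lookup))
        (trans (sym (evalWord≡apply (subword word G))) (trans evalG πperm≡π)))
      L-length : suc (length L) ≡ suc k
      L-length = trans (↭-length L↭) (trans (length-map (lookup (Γ n k)) I) I-length)
      L∈ : All (λ e → inF e ≡ true × e ∈ Γ n k) (d ∷ L)
      L∈ = All-resp-↭ (↭-sym L↭) (All.map⁺ (All.map (λ {i} i∈F → trans (inF-lookup i) ([]=⇒lookup i∈F) , ∈-lookup i) I∈))
      u : ℕ
      u = proj₁ d
      d∈row : d ∈ row n k u
      d∈row = proj₁ (∈-Γ⁻ {n} {k} (proj₂ (All.head L∈)))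
      1≤ : All (λ e → 1 ≤ proj₁ e) (d ∷ L)
      1≤ = All.map (λ (_ , e∈) → proj₂ (∈-Γ⁻ {n} {k} e∈)) L∈
      ≪-chain : AllPairs (λ d e → e ≪ d) (d ∷ L)
      ≪-chain = AllPairs.map proj₁ chain
      k<u : k < u
      k<u = ≤-trans (≤-reflexive (sym L-length)) (chain-length d L (All.head 1≤) (All.tail 1≤) ≪-chain)
      u≤M : u ≤ M
      u≤M with _ , x≤M , a≤x ← row-letter {n} {k} {M} n≡ d∈row = ≤-trans a≤x x≤M
      w : ℕ
      w = n ∸ u
      u+w≡n : u + w ≡ n
      u+w≡n = m+[n∸m]≡n (≤-trans u≤M (≤-trans (n≤1+n M) (≤-trans (m≤m+n (suc M) k) (≤-reflexive (sym n≡)))))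
      k≤w : k ≤ w
      k≤w = opposite-≥ {u} {w} (trans u+w≡n n≡) (m≤n⇒m≤1+n u≤M)
      b≤n : ∀ {e} → e ∈ Γ n k → proj₂ e ≤ n
      b≤n {e} e∈ = proj₁ (proj₂ (proj₂ (∈-row⁻ {n} {k} {proj₁ e} (proj₁ (∈-Γ⁻ {n} {k} e∈)))))
      u<b : All (λ e → u < proj₂ e) (d ∷ L)
      u<b = proj₁ (proj₂ (∈-row⁻ {n} {k} {u} d∈row)) ∷ All.map proj₂ d>
      a≤u : All (λ e → proj₁ e ≤ u) (d ∷ L)
      a≤u = ≤-refl ∷ All.map (<⇒≤ ∘ proj₁ ∘ proj₁) d>
      positive : 1 ≤ above (suc w) (state u) u
      positive = height-positive {u} {_} {k} (subst (λ c → u + c ≤ above (suc w) (state u) u + u + k) L-length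
        (Avoiding.chain-height {n} {k} {M} n≡ (λ d _ → inG d) inF avoids u+w≡n (<⇒≤ k<u) (m≤n⇒m≤1+n u≤M)
          (d ∷ L) u u ≤-refl (<⇒≤ k<u) u≤M (+-monoʳ-≤ u (≤-trans (m≤m+n u w) (≤-reflexive u+w≡n)))
          (All.zipWith (λ ((f , e∈) , u<b) → f , proj₁ (∈-Γ⁻ {n} {k} e∈) , proj₂ (∈-Γ⁻ {n} {k} e∈) , u<b) (L∈ , u<b))
          ≪-chain
          (All.zipWith (λ { {e} ((_ , e∈) , a≤u) → a≤u , ≤-trans (≤-reflexive (+-comm (proj₂ e) u)) (+-monoʳ-≤ u (b≤n e∈)) }) (L∈ , a≤u))))
      zero-height : above (suc w) (state u) u ≡ 0
      zero-height = begin
        above (suc w) (state u) u       ≡⟨ state-above-after (suc w) u w ⟨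
        above (suc w) (state (w + u)) u ≡⟨ cong (λ t → above (suc w) (state t) u) (trans (+-comm w u) u+w≡n) ⟩
        above (suc w) (state n) u       ≡⟨ cong (λ p → above (suc w) p u) final≡π ⟩
        above (suc w) π u               ≡⟨ cong₂ (λ w u → above (suc w) π u) k+j≡ k+i≡ ⟨
        above (suc (k + (w ∸ k))) π (k + (u ∸ k)) ≡⟨ above-π k (suc m) (u ∸ k) (w ∸ k) (opposite-sum⁻ {k} (u ∸ k) (w ∸ k) (trans (cong₂ _+_ k+i≡ k+j≡) (trans u+w≡n n≡))) ⟩
        0                               ∎
        where
        open ≡-Reasoning
        k+i≡ : k + (u ∸ k) ≡ u
        k+i≡ = m+[n∸m]≡n (<⇒≤ k<u)
        k+j≡ : k + (w ∸ k) ≡ w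
        k+j≡ = m+[n∸m]≡n k≤w

  -- The word is a variable so that matching on the equation carries everything over to
  -- `Q′word n k`, which equals `word` only propositionally.
  isomorphism : ∀ w → w ≡ word → Σ (Fin (length (Γ n k)) ↔ Fin (length w)) λ τ →
    (F : Subset (length (Γ n k))) → IsFaceΔ n k F ⇔ IsFaceSubword (n ∸ k) w (πperm n k) (imageSubset τ F)
  isomorphism w refl = σ , λ F → mk⇔ (face⇒subword F) (subword⇒face F)

theorem2p1 : (n k : ℕ) → 1 ≤ k → 1 ≤ n → 2 * k + 1 ≤ n →
    Σ (Fin (length (Γ n k)) ↔ Fin (length (Q′word n k))) λ σ →
    (F : Subset (length (Γ n k))) →
    IsFaceΔ n k F ⇔ IsFaceSubword (n ∸ k) (Q′word n k) (πperm n k) (imageSubset σ F)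
-- Here `m` is n - 2k - 1, so that `M = k + m`.
theorem2p1 n k _ _ 2k+1≤n with m , refl ← m≤n⇒∃[o]m+o≡n 2k+1≤n =
  Main.isomorphism {n} {k} {m} (n-split k m) (Q′word n k) (Q′word-letters {n} {k} {k + m} (n-split k m))
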